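{- Let $\mathbb{K}$ be an associative ring with unity (not necessarily commutative). Let $p,q$ be positive integers, let $P=[p]\times[q]$ be the $p\times q$-rectangle, and let $f\in\mathbb{K}^{\widehat{P}}$ be a $\mathbb{K}$-labeling of $P$ such that $R^{p+q}f\neq\bot$, where $R$ is birational rowmotion of $P$. Set $a=f(0)$ and $b=f(1)$. Then $a$ and $b$ are invertible in $\mathbb{K}$, and for every $x\in\widehat{P}$ we have $$\left(R^{p+q}f\right)(x)=a\,b^{ -1}\cdot f(x)\cdot a^{ -1}\,b.$$
   Context: $\mathbb{K}$ is a fixed associative ring with unity, not necessarily commutative. An element is invertible if it has a two-sided inverse $x^{ -1}$. An equality in which an inverse $x^{ -1}$ appears is understood to include the assertion that $x$ is invertible (unless this is assumed). $\mathbb{N}=\{0,1,2,\ldots\}$. Extended poset. For a finite poset $P$, $\widehat{P}$ is the poset on the disjoint union $P\sqcup\{0,1\}$ in which $u\le v$ iff ($u,v\in P$ and $u\le v$ in $P$) or $u=0$ or $v=1$. Write $u\lessdot v$ (equivalently $v\gtrdot u$) if $u<v$ and no $w$ satisfies $u<w<v$ (in $\widehat{P}$). Labelings and partial maps. A $\mathbb{K}$-labeling of $P$ is a map $f:\widehat{P}\to\mathbb{K}$; the set of these is $\mathbb{K}^{\widehat{P}}$. A partial map $F:X\dashrightarrow Y$ is a map $X\to Y\sqcup\{\bot\}$, where $\bot$ means "undefined"; it is extended by $F(\bot)=\bot$, and partial maps are composed accordingly. Toggles. For $v\in P$, the toggle $T_v:\mathbb{K}^{\widehat{P}}\dashrightarrow\mathbb{K}^{\widehat{P}}$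 is defined by $(T_vf)(w)=f(w)$ for $w\ne v$ and $$(T_vf)(v)=\Big(\sum_{u\in\widehat{P},\,u\lessdot v}f(u)\Big)\cdot f(v)^{ -1}\cdot\Big(\sum_{u\in\widehat{P},\,u\gtrdot v}f(u)^{ -1}\Big)^{ -1};$$ if any inverse in this formula does not exist, then $T_vf:=\bot$. Birational rowmotion. $R:=T_{v_1}\circ T_{v_2}\circ\cdots\circ T_{v_m}:\mathbb{K}^{\widehat{P}}\dashrightarrow\mathbb{K}^{\widehat{P}}$, where $(v_1,\ldots,v_m)$ is any linear extension of $P$ (a list of all elements of $P$, each exactly once, such that $v_i<v_j$ implies $i<j$); so the toggles at larger elements are applied first. This partial map does not depend on the choice of linear extension. $R^k$ is the $k$-fold composition, $R^0=\mathrm{id}$. Rectangle. For positive integers $p,q$, the $p\times q$-rectangle is $[p]\times[q]$ with $[n]=\{1,\ldots,n\}$ and order $(i,j)\le(i',j')$ iff $i\le i'$ and $j\le j'$. -}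

module Defs where

open import Algebra.Bundles using (Ring)
import Algebra.Definitions as AlgebraDefinitions
open import Data.Bool.Base using (if_then_else_)
open import Data.Fin.Base as Fin using (Fin)
import Data.Fin.Properties as Fin
open import Data.List.Base
  using (List; []; _∷_; map; foldr; filter; length; lookup; allFin; cartesianProduct)
open import Data.List.Membership.Propositional using (_∈_; lose)
open import Data.List.Membership.Propositional.Properties
  using (∈-map⁺; ∈-allFin; ∈-cartesianProduct⁺)
open import Data.List.Relation.Unary.All as All using (All)
open import Data.List.Relation.Unary.Any as Any using (here; there)
open import Data.List.Relation.Unary.Unique.Propositional using (Unique)
import Data.List.Relation.Unary.Unique.Propositional.Properties as Unique
open import Data.Nat.Base using (ℕ; zero; suc)
open import Data.Product.Base using (Σ-syntax; ∃-syntax; _×_; _,_; proj₁)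
open import Data.Product.Properties using (≡-dec)
open import Data.Product.Relation.Binary.Pointwise.NonDependent using (Pointwise)
open import Data.Unit.Polymorphic.Base using (⊤)
open import Level using (Level; 0ℓ; _⊔_) renaming (suc to lsuc)
open import Relation.Binary.Core using (Rel)
open import Relation.Binary.Definitions using (Decidable)
open import Relation.Binary.PropositionalEquality
  using (_≡_; refl; cong₂; isEquivalence)
open import Relation.Binary.Structures using (IsDecPartialOrder)
import Relation.Binary.Construct.Add.Extrema.NonStrict as AddExtrema
import Relation.Binary.Construct.NonStrictToStrict as ToStrict
open import Relation.Nullary using (¬_; Dec; does)
open import Relation.Nullary.Construct.Add.Extrema using (_±; ⊥±; ⊤±; [_])
open import Relation.Nullary.Decidable using (map′; ¬?; _×-dec_)

-- A partial map X ⇀ Y sends x to a domain of definition together with a value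
-- for each proof of definedness; "F x ≠ ⊥" is rendered by giving an element of
-- Defined (F x).  (A function into Maybe Y would require invertibility in the
-- base ring to be decidable.)

record Partial {a} (d : Level) (A : Set a) : Set (a ⊔ lsuc d) where
  constructor partial
  field
    Defined : Set d
    value   : Defined → A

open Partial public

module PartialMap (d : Level) where

  infixr 9 _⊙_
  infixr 10 _^_

  _⇀_ : ∀ {a b} → Set a → Set b → Set (a ⊔ b ⊔ lsuc d)
  X ⇀ Y = X → Partial d Y

  _⊙_ : ∀ {a b c} {X : Set a} {Y : Set b} {Z : Set c} → (Y ⇀ Z) → (X ⇀ Y) → (X ⇀ Z)
  Defined ((G ⊙ F) x)         = Σ[ t ∈ Defined (F x) ] Defined (G (value (F x) t))
  value   ((G ⊙ F) x) (t , s) = value (G (value (F x) t)) s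

  idₚ : ∀ {a} {X : Set a} → X ⇀ X
  idₚ x = partial ⊤ (λ _ → x)

  _^_ : ∀ {a} {X : Set a} → (X ⇀ X) → ℕ → (X ⇀ X)
  F ^ zero  = idₚ
  F ^ suc k = F ⊙ (F ^ k)

record FinitePoset : Set₁ where
  infix 4 _≤_
  field
    Carrier           : Set
    _≤_               : Rel Carrier 0ℓ
    isDecPartialOrder : IsDecPartialOrder _≡_ _≤_
    elements          : List Carrier
    complete          : ∀ x → x ∈ elements
    unique            : Unique elements

  open ToStrict _≡_ _≤_ public using (_<_)

  record LinearExtension : Set where
    field
      list      : List Carrier
      exhausts  : ∀ x → x ∈ list
      distinct  : Unique list
      increases : ∀ i j → lookup list i < lookup list j → i Fin.< j

-- The extended poset: ⊥± and ⊤± are the added elements 0 and 1.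
module Extended (P : FinitePoset) where
  open FinitePoset P using (Carrier; elements; complete; isDecPartialOrder) renaming (_≤_ to _≤ₚ_)

  P̂ : Set
  P̂ = Carrier ±

  open AddExtrema _≤ₚ_ public using () renaming (_≤±_ to _≤̂_)
  open ToStrict _≡_ _≤̂_ public using () renaming (_<_ to _<̂_)

  open IsDecPartialOrder (AddExtrema.≤±-isDecPartialOrder-≡ _≤ₚ_ isDecPartialOrder) public
    using () renaming (_≟_ to _≟̂_; _≤?_ to _≤̂?_)

  infix 4 _⋖_

  _⋖_ : Rel P̂ 0ℓ
  u ⋖ v = u <̂ v × ¬ (∃[ w ] (u <̂ w × w <̂ v))

  elementŝ : List P̂
  elementŝ = ⊥± ∷ ⊤± ∷ map [_] elements

  completê : ∀ x → x ∈ elementŝ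
  completê ⊥±    = here refl
  completê ⊤±    = there (here refl)
  completê [ x ] = there (there (∈-map⁺ [_] (complete x)))

  _<̂?_ : Decidable _<̂_
  u <̂? v = (u ≤̂? v) ×-dec ¬? (u ≟̂ v)

  _⋖?_ : Decidable _⋖_
  u ⋖? v = (u <̂? v) ×-dec ¬? between?
    where
    between? : Dec (∃[ w ] (u <̂ w × w <̂ v))
    between? = map′ Any.satisfied (λ (w , p) → lose (completê w) p)
                    (Any.any? (λ w → (u <̂? w) ×-dec (w <̂? v)) elementŝ)

  lowerCovers upperCovers : P̂ → List P̂
  lowerCovers v = filter (λ u → u ⋖? v) elementŝ
  upperCovers v = filter (λ u → v ⋖? u) elementŝ

module Rowmotion {c ℓ} (K : Ring c ℓ) (P : FinitePoset) where
  open Ring K renaming (Carrier to 𝕂)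
  open FinitePoset P using (Carrier; LinearExtension) public
  open Extended P public
  open PartialMap (c ⊔ ℓ) public

  Invertible : 𝕂 → Set (c ⊔ ℓ)
  Invertible = AlgebraDefinitions.Invertible _≈_ 1# _*_

  inv : ∀ {x} → Invertible x → 𝕂
  inv = proj₁

  ∑ : List 𝕂 → 𝕂
  ∑ = foldr _+_ 0#

  Labeling : Set c
  Labeling = P̂ → 𝕂

  -- Defined exactly when f v, all f u with v ⋖ u, and the sum of the inverses
  -- of the latter are invertible.
  T : Carrier → Labeling ⇀ Labeling
  Defined (T v f) =
    Invertible (f [ v ]) ×
    (Σ[ is ∈ All (λ u → Invertible (f u)) (upperCovers [ v ]) ] Invertible (∑ (All.reduce inv is)))
  value (T v f) (fv⁻¹ , is , s⁻¹) w =
    if does (w ≟̂ [ v ])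
      then ∑ (map f (lowerCovers [ v ])) * inv fv⁻¹ * inv s⁻¹
      else f w

  -- The last element of the list is toggled first.
  R : LinearExtension → Labeling ⇀ Labeling
  R L = foldr (λ v G → T v ⊙ G) idₚ (LinearExtension.list L)

-- [n] is Fin n, so coordinates start at 0.
rectangle : ℕ → ℕ → FinitePoset
rectangle p q = record
  { Carrier           = Fin p × Fin q
  ; _≤_               = Pointwise Fin._≤_ Fin._≤_
  ; isDecPartialOrder = record
    { isPartialOrder = record
      { isPreorder = record
        { isEquivalence = isEquivalence
        ; reflexive     = λ { refl → Fin.≤-refl , Fin.≤-refl }
        ; trans         = λ (a , b) (c , d) → Fin.≤-trans a c , Fin.≤-trans b d
        }
      ; antisym = λ (a , b) (c , d) → cong₂ _,_ (Fin.≤-antisym a c) (Fin.≤-antisym b d)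
      }
    ; _≟_  = ≡-dec Fin._≟_ Fin._≟_
    ; _≤?_ = λ (i , j) (i′ , j′) → (i Fin.≤? i′) ×-dec (j Fin.≤? j′)
    }
  ; elements = cartesianProduct (allFin p) (allFin q)
  ; complete = λ (i , j) → ∈-cartesianProduct⁺ (∈-allFin i) (∈-allFin j)
  ; unique   = Unique.cartesianProduct⁺ (Unique.allFin⁺ p) (Unique.allFin⁺ q)
  }

{-# OPTIONS --safe #-}

-- Place P̂ in ℕ × ℕ with (i , j) at its own (1-based) coordinates, 0 at (1 , 0) and
-- 1 at (p , q + 1): the covers are then exactly the unit steps up in one coordinate.
-- Let F t be the labeling Rᵗ f on these points, G t its pointwise inverse, both
-- extended by 0, and let a = f 0, b = f 1.  The toggles become
--   F (t+1) i j · (G (t+1) (i+1) j + G (t+1) i (j+1)) = (F t (i-1) j + F t i (j-1)) · G t i j,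
-- and we call the right-hand side α t i j.  On sequences w indexed by the rows, let
-- L t j w = α t j · w - shift w and let P t be the composite L t 1 ∘ ⋯ ∘ L t q.
--   (1) P t maps the column F t · q to F t · 0 = (a , 0 , … , 0).
--   (2) Σᵢ G (t+1) i 1 · (P t w) i = b⁻¹ · w p.
--   (3) P t ∘ shift = shift ∘ P (t-1).  Write L t j = X j + γ j, where γ j is the
--       multiplication by F t · (j-1) times G t · j.  The toggle equation
--       gives shift ∘ L (t-1) j = (X j + γ′ (j+1)) ∘ shift, with γ′ the shift of
--       γ, and X j ∘ γ (j+1) = γ′ (j+1) ∘ X (j+1).  Hence
--       X j (X (j+1) + γ (j+1)) = (X j + γ′ (j+1)) X (j+1), and since γ 1 and γ′ (q+1)
--       vanish on shifted sequences, one product turns into the other factor by factor.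
-- Together these give G (s+i) i 1 = b⁻¹ · F s (p+1-i) q · a⁻¹, which is the reciprocity
--   F (s+i+j-1) i j = a · G s (p+1-i) (q+1-j) · b
-- for j = 1.  Comparing the toggle at a point with the toggle at its antipode carries
-- it from columns j - 1 and j to column j + 1, and applying reciprocity twice gives
-- the periodicity.
module Submission where

open import Defs
open import Algebra.Bundles using (Ring)
open import Data.Bool.Base using (if_then_else_)
open import Data.Fin.Base as Fin using (toℕ; fromℕ; fromℕ<; inject₁)
import Data.Fin.Properties as Fin
open import Data.List.Base using (List; []; _∷_; _++_; map; foldr; filter)
open import Data.List.Properties
  using (map-cong-local; filter-none; filter-accept; filter-reject; tabulate-lookup)
open import Data.List.Membership.Propositional using (_∈_)
open import Data.List.Membership.Propositional.Properties using (∈-∃++; ∈-filter⁺; ∈-filter⁻; ∈-++⁺ʳ)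
open import Data.List.Relation.Unary.All as All using (All; []; _∷_)
import Data.List.Relation.Unary.All.Properties as All
open import Data.List.Relation.Unary.AllPairs as AllPairs using (AllPairs; []; _∷_)
open import Data.List.Relation.Unary.AllPairs.Properties using (tabulate⁺-<)
open import Data.List.Relation.Unary.Any using (here; there)
open import Data.List.Relation.Unary.Unique.Propositional using (Unique)
import Data.List.Relation.Unary.Unique.Propositional.Properties as Unique
open import Data.Nat.Base as ℕ using (ℕ; zero; suc; z≤n; s≤s; s≤s⁻¹)
import Data.Nat.Properties as ℕ
open import Data.Nat.Tactic.RingSolver using (solve-∀)
open import Data.Product.Base using (Σ-syntax; ∃-syntax; _×_; _,_; proj₁; proj₂)
open import Data.Product.Properties using (≡-dec)
open import Data.Sum.Base using (_⊎_; inj₁; inj₂; [_,_]′)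
open import Function.Base using (_∘_)
open import Level using (_⊔_)
open import Relation.Binary.Core using (Rel)
import Relation.Binary.Construct.Add.Extrema.NonStrict as AddExtrema
open import Relation.Binary.PropositionalEquality as ≡ using (_≡_; _≢_)
open import Relation.Nullary using (¬_; Dec; does; yes; no; contradiction)
open import Relation.Nullary.Construct.Add.Extrema using (⊥±; ⊤±; [_]; [_]-injective)
open import Relation.Nullary.Decidable using (dec-true; dec-false)
open import Relation.Unary using (Pred; Decidable)

-- Sequences indexed by rows: shifts, twists and finite sums.

module Sequences {c ℓ} (K : Ring c ℓ) where
  open Ring K renaming (Carrier to 𝕂)
  open import Algebra.Properties.Ring K
  open import Algebra.Solver.CommutativeMonoid +-commutativeMonoid using (solve; _⊕_; _⊜_)
  open import Relation.Binary.Reasoning.Setoid setoid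

  Sequence : Set c
  Sequence = ℕ → 𝕂

  infixl 7 _⊛_
  _⊛_ : Sequence → Sequence → Sequence
  (c ⊛ w) x = c x * w x

  shift : Sequence → Sequence
  shift w zero    = 0#
  shift w (suc x) = w x

  shift^ : ℕ → Sequence → Sequence
  shift^ zero    w = w
  shift^ (suc n) w = shift (shift^ n w)

  shift^-+ : ∀ n w x → shift^ n w (n ℕ.+ x) ≡ w x
  shift^-+ zero    w x = ≡.refl
  shift^-+ (suc n) w x = shift^-+ n w x

  shift^-< : ∀ {n x} w → x ℕ.< n → shift^ n w x ≡ 0#
  shift^-< {suc n} {zero}  w _         = ≡.refl
  shift^-< {suc n} {suc x} w (s≤s x<n) = shift^-< w x<n

  twist : Sequence → Sequence → Sequence
  twist α w x = α x * w x - shift w x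

  Σ< : ℕ → Sequence → 𝕂
  Σ< zero    h = 0#
  Σ< (suc n) h = Σ< n h + h n

  Σ<-zero : ∀ n {h} → (∀ x → x ℕ.< n → h x ≈ 0#) → Σ< n h ≈ 0#
  Σ<-zero zero    h≈0 = refl
  Σ<-zero (suc n) h≈0 =
    trans (+-cong (Σ<-zero n λ x x<n → h≈0 x (ℕ.m<n⇒m<1+n x<n)) (h≈0 n (ℕ.n<1+n n))) (+-identityˡ 0#)

  Σ<-single : ∀ n {h k} → k ℕ.< n → (∀ x → x ℕ.< n → ¬ x ≡ k → h x ≈ 0#) → Σ< n h ≈ h k
  Σ<-single (suc n) {h} {k} k<1+n h≈0 with k ℕ.≟ n
  ... | yes ≡.refl = trans (+-congʳ (Σ<-zero n λ x x<n → h≈0 x (ℕ.m<n⇒m<1+n x<n) (ℕ.<⇒≢ x<n))) (+-identityˡ _)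
  ... | no  k≢n    = trans (+-cong (Σ<-single n (ℕ.≤∧≢⇒< (s≤s⁻¹ k<1+n) k≢n)
                                     λ x x<n → h≈0 x (ℕ.m<n⇒m<1+n x<n))
                                   (h≈0 n (ℕ.n<1+n n) λ n≡k → k≢n (≡.sym n≡k)))
                           (+-identityʳ _)

  -- Summation by parts. The part `h (suc x)` of `h x * α x` telescopes against the `shift w` term
  -- of the next summand; only the end term at `n` survives, since `shift w` vanishes at 0.
  Σ<-twist : ∀ n {h h′ α} w → (∀ x → x ℕ.< n → h x * α x ≈ h (suc x) + h′ x) →
             Σ< n (h ⊛ twist α w) ≈ h n * shift w n + Σ< n (h′ ⊛ w)
  Σ<-twist zero    w hα = sym (trans (+-identityʳ _) (zeroʳ _))
  Σ<-twist (suc n) {h} {h′} {α} w hα = begin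
    Σ< n (h ⊛ twist α w) + h n * (α n * w n - shift w n)
      ≈⟨ +-cong (Σ<-twist n w λ x x<n → hα x (ℕ.m<n⇒m<1+n x<n)) (x[y-z]≈xy-xz _ _ _) ⟩
    (u + S) + (h n * (α n * w n) - u)
      ≈⟨ +-congˡ (+-congʳ (trans (sym (*-assoc _ _ _)) (trans (*-congʳ (hα n (ℕ.n<1+n n))) (distribʳ _ _ _)))) ⟩
    (u + S) + ((h (suc n) * w n + h′ n * w n) - u)
      ≈⟨ solve 5 (λ u S y z -u → (u ⊕ S) ⊕ ((y ⊕ z) ⊕ -u) ⊜ (u ⊕ -u) ⊕ (y ⊕ (S ⊕ z))) refl
           u S (h (suc n) * w n) (h′ n * w n) (- u) ⟩
    (u - u) + (h (suc n) * w n + (S + h′ n * w n))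
      ≈⟨ trans (+-congʳ (-‿inverseʳ u)) (+-identityˡ _) ⟩
    h (suc n) * w n + (S + h′ n * w n) ∎
    where
    u = h n * shift w n
    S = Σ< n (h′ ⊛ w)

-- The labelings of all times as arrays on ℕ × ℕ.

-- The underlying rectangle is (p + 1) × (q + 1), with one-based coordinates.
record Grid {c ℓ} (K : Ring c ℓ) (p q N : ℕ) : Set (c ⊔ ℓ) where
  open Ring K renaming (Carrier to 𝕂)
  field
    F G         : ℕ → ℕ → ℕ → 𝕂
    a a⁻¹ b b⁻¹ : 𝕂
    aa⁻¹        : a * a⁻¹ ≈ 1#
    a⁻¹a        : a⁻¹ * a ≈ 1#
    bb⁻¹        : b * b⁻¹ ≈ 1#
    b⁻¹b        : b⁻¹ * b ≈ 1#
    FG          : ∀ {t i j} → t ℕ.≤ N → i ℕ.≤ p → j ℕ.≤ q → F t (suc i) (suc j) * G t (suc i) (suc j) ≈ 1#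
    GF          : ∀ {t i j} → t ℕ.≤ N → i ℕ.≤ p → j ℕ.≤ q → G t (suc i) (suc j) * F t (suc i) (suc j) ≈ 1#
    F-left      : ∀ t j → F t 0 j ≈ 0#
    F-bottom    : ∀ t i → F t (suc (suc i)) 0 ≈ 0#
    F-origin    : ∀ {t} → t ℕ.≤ N → F t 1 0 ≈ a
    G-right     : ∀ t {j} → j ℕ.≤ q → G t (suc (suc p)) (suc j) ≈ 0#
    G-top       : ∀ t {i} → i ℕ.< p → G t (suc i) (suc (suc q)) ≈ 0#
    G-end       : ∀ {t} → t ℕ.≤ N → G t (suc p) (suc (suc q)) ≈ b⁻¹
    toggle      : ∀ {t i j} → t ℕ.< N → i ℕ.≤ p → j ℕ.≤ q →
                  F (suc t) (suc i) (suc j) * (G (suc t) (suc (suc i)) (suc j) + G (suc t) (suc i) (suc (suc j)))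
                    ≈ (F t i (suc j) + F t (suc i) j) * G t (suc i) (suc j)

-- Reciprocity and periodicity in coordinates.

module Reciprocity {c ℓ} {K : Ring c ℓ} {p q N : ℕ} (grid : Grid K p q N) where
  open Ring K renaming (Carrier to 𝕂)
  open Grid grid
  open Sequences K
  open import Algebra.Properties.Ring K
  open import Algebra.Properties.Monoid *-monoid using (cancelˡ; cancelʳ; cancelᶜ)
  open import Algebra.Solver.CommutativeMonoid +-commutativeMonoid using (solve; _⊕_; _⊜_)
  open import Relation.Binary.Reasoning.Setoid setoid

  infix 4 _≋_
  -- The laws of `Grid` are bounded to the rectangle, so sequences are compared only on its rows.
  -- `shift` and `twist` look at no later entries and hence respect this relation.
  _≋_ : Sequence → Sequence → Set ℓ
  v ≋ w = ∀ {x} → x ℕ.≤ p → v x ≈ w x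

  ≋-sym : ∀ {v w} → v ≋ w → w ≋ v
  ≋-sym v≋w x≤p = sym (v≋w x≤p)

  ≋-trans : ∀ {u v w} → u ≋ v → v ≋ w → u ≋ w
  ≋-trans u≋v v≋w x≤p = trans (u≋v x≤p) (v≋w x≤p)

  shift-cong : ∀ {v w} → v ≋ w → shift v ≋ shift w
  shift-cong v≋w {zero}  _     = refl
  shift-cong v≋w {suc x} x<p = v≋w (ℕ.<⇒≤ x<p)

  shift^-cong : ∀ n {v w} → v ≋ w → shift^ n v ≋ shift^ n w
  shift^-cong zero    v≋w = v≋w
  shift^-cong (suc n) v≋w = shift-cong (shift^-cong n v≋w)

  twist-cong : ∀ α {v w} → v ≋ w → twist α v ≋ twist α w
  twist-cong α v≋w x≤p = +-cong (*-congˡ (v≋w x≤p)) (-‿cong (shift-cong v≋w x≤p))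

  -- The composites P t on columns and on weighted sums: facts (1) and (2).

  col : ℕ → ℕ → Sequence
  col t j x = F t (suc x) j

  -- Indices are zero-based here: `α t j x` sits at the grid point `(x + 1 , j + 1)`, and
  -- `Ls t (suc q)` is the full composite P t.
  α : ℕ → ℕ → Sequence
  α t j x = (F t x (suc j) + F t (suc x) j) * G t (suc x) (suc j)

  L : ℕ → ℕ → Sequence → Sequence
  L t j = twist (α t j)

  Ls : ℕ → ℕ → Sequence → Sequence
  Ls t zero    w = w
  Ls t (suc k) w = Ls t k (L t k w)

  Ls-cong : ∀ t k {v w} → v ≋ w → Ls t k v ≋ Ls t k w
  Ls-cong t zero    v≋w = v≋w
  Ls-cong t (suc k) v≋w = Ls-cong t k (twist-cong (α t k) v≋w)

  -- Each `L` peels off one column: multiplying `α` by F cancels G and leaves the sum of the two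
  -- lower neighbours, and the shift removes the one in the same column.
  Ls-col : ∀ {t} → t ℕ.≤ N → ∀ {k} → k ℕ.≤ suc q → Ls t k (col t k) ≋ col t 0
  Ls-col t≤N {zero}  k≤q x≤p = refl
  Ls-col {t} t≤N {suc k} k<q     = ≋-trans (Ls-cong t k L-col) (Ls-col t≤N (ℕ.<⇒≤ k<q))
    where
    shift-col : ∀ x → shift (col t (suc k)) x ≈ F t x (suc k)
    shift-col zero    = sym (F-left t (suc k))
    shift-col (suc x) = refl
    L-col : L t k (col t (suc k)) ≋ col t k
    L-col {x} x≤p = begin
      (F t x (suc k) + F t (suc x) k) * G t (suc x) (suc k) * F t (suc x) (suc k) - shift (col t (suc k)) x
        ≈⟨ +-cong (cancelʳ (GF t≤N x≤p (s≤s⁻¹ k<q)) _) (-‿cong (shift-col x)) ⟩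
      F t x (suc k) + F t (suc x) k - F t x (suc k)
        ≈⟨ xyx⁻¹≈y _ _ ⟩
      F t (suc x) k ∎

  row : ℕ → ℕ → Sequence
  row t j x = G t (suc x) j

  -- Each `L` is moved onto the weights by summation by parts. By `toggle`, the weight G times `α`
  -- is the sum of G over the two upper neighbours; the one in the same column telescopes, and its
  -- end term lies beyond the last row, where G is 0.
  Σ<-Ls : ∀ {t} → t ℕ.< N → ∀ {k} → k ℕ.≤ suc q → ∀ w →
          Σ< (suc p) (row (suc t) 1 ⊛ Ls t k w) ≈ Σ< (suc p) (row (suc t) (suc k) ⊛ w)
  Σ<-Ls t<N {zero}  k≤q w = refl
  Σ<-Ls {t} t<N {suc k} k<q w = begin
    Σ< (suc p) (row (suc t) 1 ⊛ Ls t k (L t k w))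
      ≈⟨ Σ<-Ls t<N (ℕ.<⇒≤ k<q) _ ⟩
    Σ< (suc p) (row (suc t) (suc k) ⊛ L t k w)
      ≈⟨ Σ<-twist (suc p) w (λ x x<p → trans (*-congˡ (sym (toggle t<N (s≤s⁻¹ x<p) (s≤s⁻¹ k<q))))
                                             (cancelˡ (GF t<N (s≤s⁻¹ x<p) (s≤s⁻¹ k<q)) _)) ⟩
    row (suc t) (suc k) (suc p) * w p + Σ< (suc p) (row (suc t) (suc (suc k)) ⊛ w)
      ≈⟨ trans (+-congʳ (trans (*-congʳ (G-right (suc t) (s≤s⁻¹ k<q))) (zeroˡ _))) (+-identityˡ _) ⟩
    Σ< (suc p) (row (suc t) (suc (suc k)) ⊛ w) ∎

  -- Commutation of P t with the shift: fact (3).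

  ρ γ : ℕ → ℕ → Sequence
  ρ t j x = F t x (suc j) * G t (suc x) (suc j)
  γ t j x = F t (suc x) j * G t (suc x) (suc j)

  X M : ℕ → ℕ → Sequence → Sequence
  X t j     = twist (ρ t j)
  M t j w x = X t j w x + (shift (γ t (suc j)) ⊛ w) x

  Ms : ℕ → ℕ → Sequence → Sequence
  Ms t zero    w = w
  Ms t (suc k) w = Ms t k (M t k w)

  M-cong : ∀ t k {v w} → v ≋ w → M t k v ≋ M t k w
  M-cong t k v≋w x≤p = +-cong (twist-cong (ρ t k) v≋w x≤p) (*-congˡ (v≋w x≤p))

  Ms-cong : ∀ t k {v w} → v ≋ w → Ms t k v ≋ Ms t k w
  Ms-cong t zero    v≋w = v≋w
  Ms-cong t (suc k) v≋w = Ms-cong t k (M-cong t k v≋w)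

  x-0≈x : ∀ x → x - 0# ≈ x
  x-0≈x x = trans (+-congˡ -0#≈0#) (+-identityʳ x)

  x-y+z≈x+z-y : ∀ x y z → x - y + z ≈ x + z - y
  x-y+z≈x+z-y x y z = solve 3 (λ x -y z → (x ⊕ -y) ⊕ z ⊜ (x ⊕ z) ⊕ -y) refl x (- y) z

  L≋X+γ : ∀ t j w → L t j w ≋ λ x → X t j w x + (γ t j ⊛ w) x
  L≋X+γ t j w {x} _ =
    trans (+-congʳ (trans (*-congʳ (distribʳ _ _ _)) (distribʳ _ _ _))) (sym (x-y+z≈x+z-y _ _ _))

  twist-+ : ∀ α v w x → twist α (λ x → v x + w x) x ≈ twist α v x + twist α w x
  twist-+ α v w x = begin
    α x * (v x + w x) - shift (λ x → v x + w x) x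
      ≈⟨ +-cong (distribˡ _ _ _) (trans (-‿cong (shift-+ x)) (sym (-‿+-comm _ _))) ⟩
    (α x * v x + α x * w x) + (- shift v x + - shift w x)
      ≈⟨ solve 4 (λ k l m n → (k ⊕ l) ⊕ (m ⊕ n) ⊜ (k ⊕ m) ⊕ (l ⊕ n)) refl _ _ _ _ ⟩
    twist α v x + twist α w x ∎
    where
    shift-+ : ∀ x → shift (λ x → v x + w x) x ≈ shift v x + shift w x
    shift-+ zero    = sym (+-identityˡ 0#)
    shift-+ (suc x) = refl

  -- Both composites cross a unit square of the grid, along different sides: F at the lower corner
  -- times G at the upper corner remains, while G and F at the intermediate corner cancel.
  X-γ : ∀ {t j} → t ℕ.≤ N → j ℕ.< q → ∀ {w} → w 0 ≈ 0# →
        X t j (γ t (suc j) ⊛ w) ≋ shift (γ t (suc j)) ⊛ X t (suc j) w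
  X-γ t≤N j<q {w} w0≈0 {zero} x≤p = begin
    _ * (_ * w 0) - 0# ≈⟨ x-0≈x _ ⟩
    _ * (_ * w 0)      ≈⟨ *-congˡ (trans (*-congˡ w0≈0) (zeroʳ _)) ⟩
    _ * 0#             ≈⟨ zeroʳ _ ⟩
    0#                 ≈⟨ zeroˡ _ ⟨
    0# * _             ∎
  X-γ {t} {j} t≤N j<q {w} w0≈0 {suc x} x<p = begin
    F₁ * G t (2 ℕ.+ x) (1 ℕ.+ j) * (F t (2 ℕ.+ x) (1 ℕ.+ j) * G t (2 ℕ.+ x) (2 ℕ.+ j) * w (suc x)) - g * w x
      ≈⟨ +-congʳ (*-congˡ (*-assoc _ _ _)) ⟩
    F₁ * G t (2 ℕ.+ x) (1 ℕ.+ j) * (F t (2 ℕ.+ x) (1 ℕ.+ j) * v) - g * w x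
      ≈⟨ +-congʳ (trans (*-assoc _ _ _) (*-congˡ (cancelˡ (GF t≤N x<p (ℕ.<⇒≤ j<q)) v))) ⟩
    F₁ * v - g * w x
      ≈⟨ +-congʳ (*-congˡ (cancelˡ (GF t≤N (ℕ.<⇒≤ x<p) j<q) v)) ⟨
    F₁ * (G t (suc x) (2 ℕ.+ j) * (F t (suc x) (2 ℕ.+ j) * v)) - g * w x
      ≈⟨ +-congʳ (trans (sym (*-assoc _ _ _)) (*-congˡ (sym (*-assoc _ _ _)))) ⟩
    g * (F t (suc x) (2 ℕ.+ j) * G t (2 ℕ.+ x) (2 ℕ.+ j) * w (suc x)) - g * w x
      ≈⟨ x[y-z]≈xy-xz _ _ _ ⟨
    g * (F t (suc x) (2 ℕ.+ j) * G t (2 ℕ.+ x) (2 ℕ.+ j) * w (suc x) - w x) ∎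
    where
    F₁ = F t (suc x) (1 ℕ.+ j)
    g = γ t (suc j) x
    v = G t (2 ℕ.+ x) (2 ℕ.+ j) * w (suc x)

  twist-0 : ∀ α {w} → w 0 ≈ 0# → twist α w 0 ≈ 0#
  twist-0 α w0≈0 = trans (x-0≈x _) (trans (*-congˡ w0≈0) (zeroʳ _))

  X-L≋M-X : ∀ {t j} → t ℕ.≤ N → j ℕ.< q → ∀ {w} → w 0 ≈ 0# → X t j (L t (suc j) w) ≋ M t j (X t (suc j) w)
  X-L≋M-X {t} {j} t≤N j<q {w} w0≈0 {x} x≤p =
    trans (twist-cong (ρ t j) (L≋X+γ t (suc j) w) x≤p)
          (trans (twist-+ (ρ t j) (X t (suc j) w) (γ t (suc j) ⊛ w) x)
                 (+-congˡ (X-γ t≤N j<q {w} w0≈0 x≤p)))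

  -- Induction on columns: `X` enters at column 0, where it agrees with `L`, and each step moves it
  -- one column on while turning a factor `L` into `M`.
  Ls≋Ms-X : ∀ {t} → t ℕ.≤ N → ∀ {k} → k ℕ.≤ q → ∀ w → w 0 ≈ 0# → Ls t (suc k) w ≋ Ms t k (X t k w)
  Ls≋Ms-X {t} t≤N {zero} k≤q w w0≈0 {x} x≤p =
    trans (L≋X+γ t 0 w x≤p) (trans (+-congˡ (γ0 x)) (+-identityʳ _))
    where
    -- In column 0 only the bottom element contributes; it lies in entry 0 of the sequence, where
    -- `w` vanishes.
    γ0 : ∀ x → (γ t 0 ⊛ w) x ≈ 0#
    γ0 zero    = trans (*-congˡ w0≈0) (zeroʳ _)
    γ0 (suc x) = trans (*-congʳ (trans (*-congʳ (F-bottom t x)) (zeroˡ _))) (zeroˡ _)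
  Ls≋Ms-X {t} t≤N {suc k} k<q w w0≈0 =
    ≋-trans (Ls≋Ms-X t≤N (ℕ.<⇒≤ k<q) (L t (suc k) w) (twist-0 (α t (suc k)) {w} w0≈0))
            (Ms-cong t k (X-L≋M-X t≤N k<q {w} w0≈0))

  Ls≋Ms : ∀ {t} → t ℕ.≤ N → ∀ w → w 0 ≈ 0# → Ls t (suc q) w ≋ Ms t (suc q) w
  Ls≋Ms {t} t≤N w w0≈0 = ≋-trans (Ls≋Ms-X t≤N ℕ.≤-refl w w0≈0) (Ms-cong t q X≋M)
    where
    -- Past the last column G vanishes except in the last row, and the shift pushes that entry out
    -- of range.
    γq : ∀ {x} → x ℕ.≤ p → (shift (γ t (suc q)) ⊛ w) x ≈ 0#
    γq {zero}  _   = trans (*-congˡ w0≈0) (zeroʳ _)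
    γq {suc x} x<p = trans (*-congʳ (trans (*-congˡ (G-top t x<p)) (zeroʳ _))) (zeroˡ _)
    X≋M : X t q w ≋ M t q w
    X≋M x≤p = sym (trans (+-congˡ (γq x≤p)) (+-identityʳ _))

  shift-L : ∀ {t j} → t ℕ.< N → j ℕ.≤ q → ∀ w → shift (L t j w) ≋ M (suc t) j (shift w)
  shift-L {t} {j} t<N j≤q w {zero} _ = sym (trans (+-cong (twist-0 (ρ (suc t) j) {shift w} refl) (zeroˡ _)) (+-identityˡ 0#))
  shift-L {t} {j} t<N j≤q w {suc x} x<p = begin
    α t j x * w x - shift w x
      ≈⟨ +-congʳ (*-congʳ (trans (sym (toggle t<N (ℕ.<⇒≤ x<p) j≤q)) (distribˡ _ _ _))) ⟩
    (ρ (suc t) j (suc x) + γ (suc t) (suc j) x) * w x - shift w x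
      ≈⟨ +-congʳ (distribʳ _ _ _) ⟩
    ρ (suc t) j (suc x) * w x + γ (suc t) (suc j) x * w x - shift w x
      ≈⟨ x-y+z≈x+z-y _ _ _ ⟨
    M (suc t) j (shift w) (suc x) ∎

  shift-Ls : ∀ {t k} → t ℕ.< N → k ℕ.≤ suc q → ∀ w → shift (Ls t k w) ≋ Ms (suc t) k (shift w)
  shift-Ls {k = zero}  t<N k≤q w x≤p = refl
  shift-Ls {t} {suc k} t<N k<q w =
    ≋-trans (shift-Ls t<N (ℕ.<⇒≤ k<q) (L t k w)) (Ms-cong (suc t) k (shift-L t<N (s≤s⁻¹ k<q) w))

  Ls-shift : ∀ {t} → t ℕ.< N → ∀ w → Ls (suc t) (suc q) (shift w) ≋ shift (Ls t (suc q) w)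
  Ls-shift t<N w = ≋-trans (Ls≋Ms t<N (shift w) refl) (≋-sym (shift-Ls t<N ℕ.≤-refl w))

  Ls-shift^ : ∀ y {t} → y ℕ.+ t ℕ.≤ N → ∀ w →
              Ls (y ℕ.+ t) (suc q) (shift^ y w) ≋ shift^ y (Ls t (suc q) w)
  Ls-shift^ zero    y+t≤N w x≤p = refl
  Ls-shift^ (suc y) y+t<N w =
    ≋-trans (Ls-shift y+t<N (shift^ y w)) (shift-cong (Ls-shift^ y (ℕ.<⇒≤ y+t<N) w))

  -- Fact (2) is applied to the last column of time `s`, shifted by `y`. By (3) and (1), P turns
  -- this sequence into the single entry `a` at `y`, so the left side is one value of G times `a`.
  -- On the right only the weight `b⁻¹` of the top element survives, and it meets entry `y′` of the
  -- column.
  G-first-col : ∀ y {y′ s} → y ℕ.+ s ℕ.< N → y ℕ.+ y′ ≡ p →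
                G (suc (y ℕ.+ s)) (suc y) 1 ≈ b⁻¹ * F s (suc y′) (suc q) * a⁻¹
  G-first-col y {y′} {s} t<N ≡.refl = begin
    G′ y                 ≈⟨ cancelʳ aa⁻¹ _ ⟨
    G′ y * a * a⁻¹       ≈⟨ *-congʳ lhs ⟨
    Σ< (suc p) (row t 1 ⊛ Ls (y ℕ.+ s) (suc q) w) * a⁻¹
                         ≈⟨ *-congʳ (Σ<-Ls t<N ℕ.≤-refl w) ⟩
    Σ< (suc p) (row t (2 ℕ.+ q) ⊛ w) * a⁻¹
                         ≈⟨ *-congʳ rhs ⟩
    b⁻¹ * F s (suc y′) (suc q) * a⁻¹ ∎
    where
    t = suc (y ℕ.+ s)
    G′ = row t 1
    w = shift^ y (col s (suc q))

    Ls-w : Ls (y ℕ.+ s) (suc q) w ≋ shift^ y (col s 0)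
    Ls-w = ≋-trans (Ls-shift^ y (ℕ.<⇒≤ t<N) _)
                   (shift^-cong y (Ls-col (ℕ.≤-trans (ℕ.m≤n+m s y) (ℕ.<⇒≤ t<N)) ℕ.≤-refl))

    off-diagonal : ∀ x → ¬ x ≡ y → shift^ y (col s 0) x ≈ 0#
    off-diagonal x x≢y with x ℕ.<? y
    ... | yes x<y = reflexive (shift^-< _ x<y)
    ... | no  x≮y with ℕ.m≤n⇒∃[o]m+o≡n (ℕ.≮⇒≥ x≮y)
    ...   | zero  , y+0≡x = contradiction (≡.trans (≡.sym y+0≡x) (ℕ.+-identityʳ y)) x≢y
    ...   | suc z , ≡.refl = trans (reflexive (shift^-+ y _ (suc z))) (F-bottom s z)

    lhs : Σ< (suc p) (row t 1 ⊛ Ls (y ℕ.+ s) (suc q) w) ≈ G′ y * a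
    lhs = begin
      Σ< (suc p) (row t 1 ⊛ Ls (y ℕ.+ s) (suc q) w)
        ≈⟨ Σ<-single (suc p) (s≤s (ℕ.m≤m+n y y′)) (λ x x<p x≢y →
             trans (*-congˡ (trans (Ls-w (s≤s⁻¹ x<p)) (off-diagonal x x≢y))) (zeroʳ _)) ⟩
      G′ y * Ls (y ℕ.+ s) (suc q) w y
        ≈⟨ *-congˡ (Ls-w (ℕ.m≤m+n y y′)) ⟩
      G′ y * shift^ y (col s 0) y
        ≡⟨ ≡.cong (λ z → G′ y * shift^ y (col s 0) z) (ℕ.+-identityʳ y) ⟨
      G′ y * shift^ y (col s 0) (y ℕ.+ 0)
        ≈⟨ *-congˡ (trans (reflexive (shift^-+ y _ 0)) (F-origin (ℕ.≤-trans (ℕ.m≤n+m s y) (ℕ.<⇒≤ t<N)))) ⟩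
      G′ y * a ∎

    rhs : Σ< (suc p) (row t (2 ℕ.+ q) ⊛ w) ≈ b⁻¹ * F s (suc y′) (suc q)
    rhs = begin
      Σ< (suc p) (row t (2 ℕ.+ q) ⊛ w)
        ≈⟨ Σ<-single (suc p) (ℕ.n<1+n p) (λ x x<p x≢p →
             trans (*-congʳ (G-top t (ℕ.≤∧≢⇒< (s≤s⁻¹ x<p) x≢p))) (zeroˡ _)) ⟩
      G t (suc p) (2 ℕ.+ q) * w p
        ≈⟨ *-cong (G-end t<N) (reflexive (shift^-+ y _ y′)) ⟩
      b⁻¹ * F s (suc y′) (suc q) ∎


  -- Reciprocity in all columns, by induction.

  -- With zero-based i and j: (i , j) and (i′ , j′) are antipodal, and the two
  -- times differ by i + j + 1.
  RecF RecG : ℕ → ℕ → Set ℓ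
  RecF i j = ∀ {i′ j′ s t} → i ℕ.+ i′ ≡ p → j ℕ.+ j′ ≡ q → t ≡ suc (s ℕ.+ (i ℕ.+ j)) → t ℕ.≤ N →
             F t (suc i) (suc j) ≈ a * G s (suc i′) (suc j′) * b
  RecG i j = ∀ {i′ j′ s t} → i ℕ.+ i′ ≡ p → j ℕ.+ j′ ≡ q → t ≡ suc (s ℕ.+ (i ℕ.+ j)) → t ℕ.≤ N →
             G t (suc i) (suc j) ≈ b⁻¹ * F s (suc i′) (suc j′) * a⁻¹

  conjugate-inverse : ∀ {x x⁻¹} → x * x⁻¹ ≈ 1# → (b⁻¹ * x * a⁻¹) * (a * x⁻¹ * b) ≈ 1#
  conjugate-inverse {x} {x⁻¹} xx⁻¹ = begin
    (b⁻¹ * x * a⁻¹) * (a * x⁻¹ * b)   ≈⟨ *-congˡ (*-assoc _ _ _) ⟩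
    (b⁻¹ * x * a⁻¹) * (a * (x⁻¹ * b)) ≈⟨ cancelᶜ a⁻¹a _ _ ⟩
    (b⁻¹ * x) * (x⁻¹ * b)             ≈⟨ cancelᶜ xx⁻¹ _ _ ⟩
    b⁻¹ * b                           ≈⟨ b⁻¹b ⟩
    1# ∎

  conjugate-0 : ∀ x y {z} → z ≈ 0# → x * z * y ≈ 0#
  conjugate-0 x y z≈0 = trans (*-congʳ (trans (*-congˡ z≈0) (zeroʳ x))) (zeroˡ y)

  +-≡⇒≤ˡ : ∀ {m n o} → m ℕ.+ n ≡ o → m ℕ.≤ o
  +-≡⇒≤ˡ ≡.refl = ℕ.m≤m+n _ _

  +-≡⇒≤ʳ : ∀ {m n o} → m ℕ.+ n ≡ o → n ℕ.≤ o
  +-≡⇒≤ʳ {m} {n} ≡.refl = ℕ.m≤n+m n m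

  earlier : ∀ {s k t} → t ≡ suc (s ℕ.+ k) → t ℕ.≤ N → s ℕ.≤ N
  earlier {s} {k} ≡.refl t≤N = ℕ.≤-trans (ℕ.m≤m+n s k) (ℕ.<⇒≤ t≤N)

  -- Passage to inverses: the two right-hand sides are inverse to each other, as are G and F on the
  -- left.
  RecG⇒RecF : ∀ {i j} → RecG i j → RecF i j
  RecG⇒RecF {i} {j} recG {i′} {j′} {s} {t} i+i′≡p j+j′≡q t≡ t≤N = begin
    F t (suc i) (suc j)
      ≈⟨ cancelʳ (conjugate-inverse (FG (earlier t≡ t≤N) (+-≡⇒≤ʳ {i} i+i′≡p) (+-≡⇒≤ʳ {j} j+j′≡q))) _ ⟨
    F t (suc i) (suc j) * (b⁻¹ * F s (suc i′) (suc j′) * a⁻¹) * (a * G s (suc i′) (suc j′) * b)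
      ≈⟨ *-congʳ (*-congˡ (recG i+i′≡p j+j′≡q t≡ t≤N)) ⟨
    F t (suc i) (suc j) * G t (suc i) (suc j) * (a * G s (suc i′) (suc j′) * b)
      ≈⟨ trans (*-congʳ (FG t≤N (+-≡⇒≤ˡ i+i′≡p) (+-≡⇒≤ˡ j+j′≡q))) (*-identityˡ _) ⟩
    a * G s (suc i′) (suc j′) * b ∎

  -- Y is the unknown value of G above a point with values f, g of F, G; the antipode
  -- has x, y as the values of G above it and u, v as those of F below it.
  fill : ∀ {f g x y u v f′ g′ h Y} → g * f ≈ 1# →
         f * (b⁻¹ * u * a⁻¹ + Y) ≈ (a * x * b + a * y * b) * (b⁻¹ * f′ * a⁻¹) →
         g ≈ b⁻¹ * g′ * a⁻¹ → h * f′ ≈ 1# → g′ * (x + y) ≈ (u + v) * h → Y ≈ b⁻¹ * v * a⁻¹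
  fill {f} {g} {x} {y} {u} {v} {f′} {g′} {h} {Y} gf≈1 step g≈ hf′≈1 step′ = +-cancelˡ _ _ _ (begin
    b⁻¹ * u * a⁻¹ + Y
      ≈⟨ cancelˡ gf≈1 _ ⟨
    g * (f * (b⁻¹ * u * a⁻¹ + Y))
      ≈⟨ *-cong g≈ step ⟩
    b⁻¹ * g′ * a⁻¹ * ((a * x * b + a * y * b) * (b⁻¹ * f′ * a⁻¹))
      ≈⟨ *-congˡ (*-cong (trans (sym (distribʳ _ _ _)) (*-congʳ (sym (distribˡ _ _ _)))) (*-assoc _ _ _)) ⟩
    b⁻¹ * g′ * a⁻¹ * (a * (x + y) * b * (b⁻¹ * (f′ * a⁻¹)))
      ≈⟨ *-congˡ (trans (cancelᶜ bb⁻¹ _ _) (*-assoc _ _ _)) ⟩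
    b⁻¹ * g′ * a⁻¹ * (a * ((x + y) * (f′ * a⁻¹)))
      ≈⟨ cancelᶜ a⁻¹a _ _ ⟩
    b⁻¹ * g′ * ((x + y) * (f′ * a⁻¹))
      ≈⟨ trans (*-assoc _ _ _) (*-congˡ (trans (sym (*-assoc _ _ _)) (*-congʳ step′))) ⟩
    b⁻¹ * ((u + v) * h * (f′ * a⁻¹))
      ≈⟨ *-congˡ (cancelᶜ hf′≈1 _ _) ⟩
    b⁻¹ * ((u + v) * a⁻¹)
      ≈⟨ trans (sym (*-assoc _ _ _)) (trans (*-congʳ (distribˡ _ _ _)) (distribʳ _ _ _)) ⟩
    b⁻¹ * u * a⁻¹ + b⁻¹ * v * a⁻¹ ∎)

  module _ {j} (recG : ∀ i → RecG i j) {i i′ j′ s t : ℕ} (i+i′≡p : i ℕ.+ i′ ≡ p) (j+j′≡q : j ℕ.+ j′ ≡ q) where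

    -- Past the last row both sides are 0: G vanishes beyond the rectangle, and F in row 0.
    -- `RecF-previous-row` treats the first row in the same way.
    RecG-next-row : t ≡ suc (s ℕ.+ (suc i ℕ.+ j)) → t ℕ.≤ N →
                    G t (suc (suc i)) (suc j) ≈ b⁻¹ * F s i′ (suc j′) * a⁻¹
    RecG-next-row = go i′ i+i′≡p
      where
      go : ∀ i′ → i ℕ.+ i′ ≡ p → t ≡ suc (s ℕ.+ (suc i ℕ.+ j)) → t ℕ.≤ N →
           G t (suc (suc i)) (suc j) ≈ b⁻¹ * F s i′ (suc j′) * a⁻¹
      go zero     i+0≡p t≡ t≤N = trans
        (≡.subst (λ k → G t (suc (suc k)) (suc j) ≈ 0#)
                 (≡.trans (≡.sym i+0≡p) (ℕ.+-identityʳ i)) (G-right t (+-≡⇒≤ˡ j+j′≡q)))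
        (sym (conjugate-0 _ _ (F-left s _)))
      go (suc i″) i+i′≡p t≡ t≤N =
        recG (suc i) (≡.trans (≡.sym (ℕ.+-suc i i″)) i+i′≡p) j+j′≡q t≡ t≤N

    RecF-previous-row : t ≡ s ℕ.+ (i ℕ.+ j) → t ℕ.≤ N →
                        F t i (suc j) ≈ a * G s (suc (suc i′)) (suc j′) * b
    RecF-previous-row = go i i+i′≡p
      where
      go : ∀ i → i ℕ.+ i′ ≡ p → t ≡ s ℕ.+ (i ℕ.+ j) → t ℕ.≤ N →
           F t i (suc j) ≈ a * G s (suc (suc i′)) (suc j′) * b
      go zero     ≡.refl t≡ t≤N =
        trans (F-left t _) (sym (conjugate-0 _ _ (G-right s (+-≡⇒≤ʳ {j} j+j′≡q))))
      go (suc i″) i+i′≡p t≡ t≤N =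
        RecG⇒RecF (recG i″) (≡.trans (ℕ.+-suc i″ i′) i+i′≡p) j+j′≡q (≡.trans t≡ (ℕ.+-suc s _)) t≤N

  -- Reciprocity between column 0 and the column past the rectangle: the elements 0 and 1 are
  -- exchanged, with `a` read as `a * b⁻¹ * b`, and all other points compare zeros.
  RecF-bottom : ∀ {i i′ s t} → i ℕ.+ i′ ≡ p → t ≡ s ℕ.+ i → t ℕ.≤ N →
                F t (suc i) 0 ≈ a * G s (suc i′) (suc (suc q)) * b
  RecF-bottom {zero} {s = s} ≡.refl ≡.refl t≤N = begin
    F _ 1 0            ≈⟨ F-origin t≤N ⟩
    a                  ≈⟨ cancelʳ b⁻¹b a ⟨
    a * b⁻¹ * b        ≈⟨ *-congʳ (*-congˡ (G-end (ℕ.≤-trans (ℕ.m≤m+n s 0) t≤N))) ⟨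
    a * G s _ _ * b    ∎
  RecF-bottom {suc i} {i′} {s} {t} i+i′≡p _ _ =
    trans (F-bottom t i)
          (sym (conjugate-0 _ _ (G-top s (≡.subst (i′ ℕ.<_) i+i′≡p (s≤s (ℕ.m≤n+m i′ i))))))

  mutual
    reciprocityG : ∀ i j → RecG i j
    reciprocityG i zero {i′} {s = s} i+i′≡p ≡.refl ≡.refl t≤N
      rewrite ℕ.+-identityʳ i | ℕ.+-comm s i = G-first-col i t≤N i+i′≡p
    reciprocityG i (suc j) {i′} {j′} {s} i+i′≡p 1+j+j′≡q ≡.refl t<N =
      -- The toggle at `(i , j)` that ends at the current time is compared with the one at the
      -- antipode `(i′ , suc j′)` from time `s` to `suc s`. Earlier columns match every value in
      -- them except the G in the new column, which `fill` solves for.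
      fill (GF t<N i≤p j≤q)
           (trans (*-congˡ (+-congʳ (sym (RecG-next-row (λ i → reciprocityG i j) i+i′≡p j+1+j′≡q
                                            (≡.cong (λ k → suc (s ℕ.+ k)) (ℕ.+-suc i j)) t<N))))
             (trans (toggle t<N i≤p j≤q)
               (*-cong (+-cong (RecF-previous-row (λ i → reciprocityG i j) i+i′≡p j+1+j′≡q s+i+1+j≡ t≤N)
                               (RecF-previous-column i j i+i′≡p 1+j+j′≡q s+i+1+j≡ t≤N))
                       (reciprocityG i j i+i′≡p j+1+j′≡q s+i+1+j≡ t≤N))))
           (reciprocityG i j i+i′≡p j+1+j′≡q (≡.cong suc s+i+1+j≡) t<N)
           (GF (ℕ.<⇒≤ s<N) i′≤p j′<q)
           (toggle s<N i′≤p j′<q)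
      where
      t≤N = ℕ.<⇒≤ t<N
      j+1+j′≡q = ≡.trans (ℕ.+-suc j j′) 1+j+j′≡q
      i≤p = +-≡⇒≤ˡ i+i′≡p
      j≤q = +-≡⇒≤ˡ j+1+j′≡q
      i′≤p = +-≡⇒≤ʳ {i} i+i′≡p
      j′<q = +-≡⇒≤ʳ {j} j+1+j′≡q
      s<N = ℕ.≤-trans (s≤s (ℕ.m≤m+n s _)) t<N
      s+i+1+j≡ : s ℕ.+ (i ℕ.+ suc j) ≡ suc s ℕ.+ (i ℕ.+ j)
      s+i+1+j≡ = ≡.trans (≡.cong (s ℕ.+_) (ℕ.+-suc i j)) (ℕ.+-suc s (i ℕ.+ j))

    -- Here `F t (suc i) j` lies one column before the zero-based column `j`: in the column of the
    -- bottom element if `j` is zero, and otherwise in a column already reached by the induction.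
    RecF-previous-column : ∀ i j {i′ j′ s t} → i ℕ.+ i′ ≡ p → suc (j ℕ.+ j′) ≡ q →
                           t ≡ suc s ℕ.+ (i ℕ.+ j) → t ℕ.≤ N →
                           F t (suc i) j ≈ a * G (suc s) (suc i′) (suc (suc (suc j′))) * b
    RecF-previous-column i zero i+i′≡p ≡.refl t≡ t≤N =
      RecF-bottom i+i′≡p (≡.trans t≡ (≡.cong (suc _ ℕ.+_) (ℕ.+-identityʳ i))) t≤N
    RecF-previous-column i (suc j) {j′ = j′} {s} i+i′≡p j+j′≡q t≡ t≤N =
      RecG⇒RecF (reciprocityG i j) i+i′≡p
        (≡.trans (≡.trans (ℕ.+-suc j (suc j′)) (≡.cong suc (ℕ.+-suc j j′))) j+j′≡q)
        (≡.trans t≡ (≡.cong suc (≡.trans (≡.cong (s ℕ.+_) (ℕ.+-suc i j)) (ℕ.+-suc s (i ℕ.+ j))))) t≤N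

  -- Going to the antipode and back takes i + j + 1 and i′ + j′ + 1 units of time, which add up to
  -- (p + 1) + (q + 1).
  periodicity : N ≡ suc p ℕ.+ suc q → ∀ {i j} → i ℕ.≤ p → j ℕ.≤ q →
                F N (suc i) (suc j) ≈ a * b⁻¹ * F 0 (suc i) (suc j) * a⁻¹ * b
  periodicity N≡ {i} {j} i≤p j≤q with ℕ.m≤n⇒∃[o]m+o≡n i≤p | ℕ.m≤n⇒∃[o]m+o≡n j≤q
  ... | i′ , i+i′≡p | j′ , j+j′≡q = begin
    F N (suc i) (suc j)
      ≈⟨ RecG⇒RecF (reciprocityG i j) i+i′≡p j+j′≡q N≡′ ℕ.≤-refl ⟩
    a * G (suc (i′ ℕ.+ j′)) (suc i′) (suc j′) * b
      ≈⟨ *-congʳ (*-congˡ (reciprocityG i′ j′ (≡.trans (ℕ.+-comm i′ i) i+i′≡p) (≡.trans (ℕ.+-comm j′ j) j+j′≡q)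
                                        ≡.refl (earlier N≡′ ℕ.≤-refl))) ⟩
    a * (b⁻¹ * F 0 (suc i) (suc j) * a⁻¹) * b
      ≈⟨ *-congʳ (trans (sym (*-assoc _ _ _)) (*-congʳ (sym (*-assoc _ _ _)))) ⟩
    a * b⁻¹ * F 0 (suc i) (suc j) * a⁻¹ * b ∎
    where
    N≡′ : N ≡ suc (suc (i′ ℕ.+ j′) ℕ.+ (i ℕ.+ j))
    N≡′ = ≡.trans N≡ (≡.trans
      (≡.cong₂ (λ m n → suc m ℕ.+ suc n) (≡.sym i+i′≡p) (≡.sym j+j′≡q)) (rearrange i i′ j j′))
      where
      rearrange : ∀ i i′ j j′ → suc (i ℕ.+ i′) ℕ.+ suc (j ℕ.+ j′) ≡ suc (suc (i′ ℕ.+ j′) ℕ.+ (i ℕ.+ j))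
      rearrange = solve-∀

-- Filtered lists and pairwise relations.

filter-unique : ∀ {a p} {A : Set a} {P : Pred A p} (P? : Decidable P) {x xs} →
                P x → (∀ {y} → P y → y ≡ x) → x ∈ xs → Unique xs → filter P? xs ≡ x ∷ []
filter-unique P? px P⇒≡ (here ≡.refl) (x∉xs ∷ _) =
  ≡.trans (filter-accept P? px)
          (≡.cong (_ ∷_) (filter-none P? (All.map (λ x≢y py → x≢y (≡.sym (P⇒≡ py))) x∉xs)))
filter-unique P? px P⇒≡ (there x∈xs) (y∉xs ∷ xs!) =
  ≡.trans (filter-reject P? (λ py → All.lookup y∉xs x∈xs (P⇒≡ py))) (filter-unique P? px P⇒≡ x∈xs xs!)

AllPairs-around : ∀ {a r} {A : Set a} {R : Rel A r} pre {v post} → AllPairs R (pre ++ v ∷ post) →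
                  (∀ {u} → u ∈ pre → R u v) × (∀ {u} → u ∈ post → R v u)
AllPairs-around []        (v~post ∷ _) = (λ ()) , All.lookup v~post
AllPairs-around (x ∷ pre) (x~ ∷ rest) with AllPairs-around pre rest
... | before , after =
  (λ { (here ≡.refl) → All.lookup x~ (∈-++⁺ʳ pre (here ≡.refl)) ; (there u∈pre) → before u∈pre }) , after

-- Rowmotion as a local relation between consecutive labelings.

module Dynamics {c ℓ} (K : Ring c ℓ) (P : FinitePoset) where
  open Ring K renaming (Carrier to 𝕂)
  open FinitePoset P using (_<_)
  open Rowmotion K P
  open LinearExtension
  open import Algebra.Properties.Monoid *-monoid using (cancelʳ; cancelᶜ)
  open import Algebra.Solver.CommutativeMonoid +-commutativeMonoid using (solve; _⊕_; _⊜_)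
  open import Relation.Binary.Reasoning.Setoid setoid

  Invertible-resp-≈ : ∀ {x y} → x ≈ y → Invertible x → Invertible y
  Invertible-resp-≈ x≈y (z , zx , xz) = z , trans (*-congˡ (sym x≈y)) zx , trans (*-congʳ (sym x≈y)) xz

  Invertible-* : ∀ {x y} → Invertible x → Invertible y → Invertible (x * y)
  Invertible-* (x⁻¹ , x⁻¹x , xx⁻¹) (y⁻¹ , y⁻¹y , yy⁻¹) =
    y⁻¹ * x⁻¹ , trans (cancelᶜ x⁻¹x _ _) y⁻¹y , trans (cancelᶜ yy⁻¹ _ _) xx⁻¹

  Invertible-inv : ∀ {x} (i : Invertible x) → Invertible (inv i)
  Invertible-inv {x} (_ , x⁻¹x , xx⁻¹) = x , xx⁻¹ , x⁻¹x

  Invertible-cancelʳ : ∀ {x y} → Invertible y → Invertible (x * y) → Invertible x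
  Invertible-cancelʳ y⁻¹@(_ , _ , yy⁻¹) xy⁻¹ =
    Invertible-resp-≈ (cancelʳ yy⁻¹ _) (Invertible-* xy⁻¹ (Invertible-inv y⁻¹))

  inverse-unique : ∀ {x y z} → y * x ≈ 1# → x * z ≈ 1# → y ≈ z
  inverse-unique yx≈1 xz≈1 = trans (sym (cancelʳ xz≈1 _)) (trans (*-congʳ yx≈1) (*-identityˡ _))

  ∑-filter-⊎ : {P Q Q′ : P̂ → Set}
    (P? : Decidable P) (Q? : Decidable Q) (Q′? : Decidable Q′) →
    (∀ {x} → P x → Q x ⊎ Q′ x) → (∀ {x} → Q x → P x) → (∀ {x} → Q′ x → P x) →
    (∀ {x} → Q x → ¬ Q′ x) → ∀ (f : Labeling) xs →
    ∑ (map f (filter P? xs)) ≈ ∑ (map f (filter Q? xs)) + ∑ (map f (filter Q′? xs))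
  ∑-filter-⊎ P? Q? Q′? P⇒Q⊎Q′ Q⇒P Q′⇒P Q⇒¬Q′ f = go
    where
    go : ∀ xs → ∑ (map f (filter P? xs)) ≈ ∑ (map f (filter Q? xs)) + ∑ (map f (filter Q′? xs))
    go [] = sym (+-identityˡ 0#)
    go (x ∷ xs) with P? x | Q? x | Q′? x
    ... | _      | yes qx | yes q′x = contradiction q′x (Q⇒¬Q′ qx)
    ... | no ¬px | yes qx | no _   = contradiction (Q⇒P qx) ¬px
    ... | no ¬px | no _   | yes q′x = contradiction (Q′⇒P q′x) ¬px
    ... | no _   | no _   | no _   = go xs
    ... | yes px | yes _  | no _   = trans (+-congˡ (go xs)) (sym (+-assoc _ _ _))
    ... | yes px | no _   | yes _  = trans (+-congˡ (go xs))
      (solve 3 (λ x y z → x ⊕ (y ⊕ z) ⊜ y ⊕ (x ⊕ z)) refl _ _ _)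
    ... | yes px | no ¬qx | no ¬q′x with P⇒Q⊎Q′ px
    ...   | inj₁ qx = contradiction qx ¬qx
    ...   | inj₂ q′x = contradiction q′x ¬q′x

  ∑-reduce-inv : ∀ {f g : P̂ → 𝕂} {xs} (is : All (λ u → Invertible (f u)) xs) →
                 (∀ {u} → u ∈ xs → f u * g u ≈ 1#) → ∑ (All.reduce inv is) ≈ ∑ (map g xs)
  ∑-reduce-inv []                     fg≈1 = refl
  ∑-reduce-inv ((_ , f⁻¹f , _) ∷ is) fg≈1 =
    +-cong (inverse-unique f⁻¹f (fg≈1 (here ≡.refl)))
           (∑-reduce-inv is (fg≈1 ∘ there))

  T-other : ∀ {v} f (d : Defined (T v f)) {w} → w ≢ [ v ] → value (T v f) d w ≡ f w
  T-other {v} f d {w} w≢v rewrite dec-false (w ≟̂ [ v ]) w≢v = ≡.refl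

  T-self : ∀ {v} f (d : Defined (T v f)) →
           value (T v f) d [ v ] ≡
             ∑ (map f (lowerCovers [ v ])) * inv (proj₁ d) * inv (proj₂ (proj₂ d))
  T-self {v} f d rewrite dec-true ([ v ] ≟̂ [ v ]) ≡.refl = ≡.refl

  toggles : List Carrier → Labeling ⇀ Labeling
  toggles = foldr (λ v G → T v ⊙ G) idₚ

  -- The elements of `pre` are toggled after those of `post`, and a toggle changes no label but its
  -- own.
  toggles-++ : ∀ pre {post} f (d : Defined (toggles (pre ++ post) f)) →
    Σ[ d′ ∈ Defined (toggles post f) ]
      (∀ {w} → (∀ {v} → v ∈ pre → w ≢ [ v ]) →
       value (toggles (pre ++ post) f) d w ≡ value (toggles post f) d′ w)
  toggles-++ []        f d = d , λ _ → ≡.refl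
  toggles-++ (v ∷ pre) f (d , s) with toggles-++ pre f d
  ... | d′ , same = d′ , λ w∉ → ≡.trans (T-other _ s (w∉ (here ≡.refl))) (same (w∉ ∘ there))

  toggles-other : ∀ xs f (d : Defined (toggles xs f)) {w} → (∀ {v} → v ∈ xs → w ≢ [ v ]) →
                  value (toggles xs f) d w ≡ f w
  toggles-other []       f d       w∉ = ≡.refl
  toggles-other (x ∷ xs) f (d , s) w∉ =
    ≡.trans (T-other _ s (w∉ (here ≡.refl))) (toggles-other xs f d (w∉ ∘ there))

  [<]⇒< : ∀ {u v} → [ u ] <̂ [ v ] → u < v
  [<]⇒< (AddExtrema.[ u≤v ] , u≢v) = u≤v , λ u≡v → u≢v (≡.cong [_] u≡v)

  -- The trace at `v` of a whole sweep from `g` to `h`: lower covers enter with old labels, upper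
  -- covers with new ones. `toggled` has the inverse of the upper sum multiplied out, and `divides`
  -- retains that this factor is invertible, from which invertibility of the label of 0 is derived.
  record IsToggled (g h : Labeling) (v : Carrier) : Set (c ⊔ ℓ) where
    field
      old     : Invertible (g [ v ])
      new     : ∀ {u} → [ v ] ⋖ u → Invertible (h u)
      divides : ∃[ y ] Invertible y × h [ v ] ≈ ∑ (map g (lowerCovers [ v ])) * y
      toggled : ∀ (k : Labeling) → (∀ {u} → [ v ] ⋖ u → h u * k u ≈ 1#) →
                h [ v ] * ∑ (map k (upperCovers [ v ])) ≈ ∑ (map g (lowerCovers [ v ])) * inv old

  Precedes : Carrier → Carrier → Set
  Precedes u v = u ≢ v × ¬ v < u

  list-precedes : (E : LinearExtension) → AllPairs Precedes (list E)
  list-precedes E = AllPairs.zip (distinct E , ≡.subst (AllPairs _) (tabulate-lookup (list E))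
    (tabulate⁺-< (λ {i} {j} i<j j<i → ℕ.<-asym i<j (increases E j i j<i))))

  -- `f` is the labeling right before `v` is toggled, while `g` and `h` are those at the two ends of
  -- the sweep.
  T-isToggled : ∀ {v f g h} (d : Defined (T v f)) → h [ v ] ≡ value (T v f) d [ v ] →
                f [ v ] ≡ g [ v ] → (∀ {u} → u ⋖ [ v ] → f u ≡ g u) → (∀ {u} → [ v ] ⋖ u → h u ≡ f u) →
                IsToggled g h v
  T-isToggled {v} {f} {g} {h} d@(i , is , s) hv≡ fv≡gv f≡g h≡f = record
    { old     = old
    ; new     = λ v⋖u → Invertible-resp-≈ (reflexive (≡.sym (h≡f v⋖u)))
                          (All.lookup is (∈-filter⁺ ([ v ] ⋖?_) (completê _) v⋖u))
    ; divides = inv old * inv s , Invertible-* (Invertible-inv old) (Invertible-inv s) ,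
                trans hv≈ (*-assoc _ _ _)
    ; toggled = λ k hk≈1 → begin
        h [ v ] * ∑ (map k (upperCovers [ v ]))
          ≈⟨ *-cong hv≈ (sym (∑-reduce-inv is λ u∈ →
               let v⋖u = proj₂ (∈-filter⁻ ([ v ] ⋖?_) {xs = elementŝ} u∈) in
               trans (*-congʳ (reflexive (≡.sym (h≡f v⋖u)))) (hk≈1 v⋖u))) ⟩
        ∑ (map g (lowerCovers [ v ])) * inv old * inv s * ∑ (All.reduce inv is)
          ≈⟨ cancelʳ (proj₁ (proj₂ s)) _ ⟩
        ∑ (map g (lowerCovers [ v ])) * inv old ∎
    }
    where
    old : Invertible (g [ v ])
    old = ≡.subst Invertible fv≡gv i
    old≡ : ∀ {x} (eq : f [ v ] ≡ x) → inv (≡.subst Invertible eq i) ≡ inv i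
    old≡ ≡.refl = ≡.refl
    lower≡ : map f (lowerCovers [ v ]) ≡ map g (lowerCovers [ v ])
    lower≡ = map-cong-local (All.tabulate λ u∈ → f≡g (proj₂ (∈-filter⁻ (_⋖? [ v ]) {xs = elementŝ} u∈)))
    hv≈ : h [ v ] ≈ ∑ (map g (lowerCovers [ v ])) * inv old * inv s
    hv≈ = reflexive (≡.trans hv≡ (≡.trans (T-self f d)
      (≡.cong₂ (λ l x → ∑ l * x * inv s) lower≡ (≡.sym (old≡ fv≡gv)))))

  -- Elements of P below `v` stand in `pre`, so their labels are still old when `v` is toggled;
  -- those above stand in `post`, so their labels are already final.
  toggles-isToggled : ∀ {xs v} → AllPairs Precedes xs → v ∈ xs → ∀ g (d : Defined (toggles xs g)) →
                      IsToggled g (value (toggles xs g) d) v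
  toggles-isToggled {v = v} precedes v∈xs g d with ∈-∃++ v∈xs
  ... | pre , post , ≡.refl with AllPairs-around pre precedes | toggles-++ pre g d
  ...   | before , after | (dpost , dv) , same = T-isToggled dv
    (same (λ x∈pre v≡x → proj₁ (before x∈pre) (≡.sym ([_]-injective v≡x))))
    (toggles-other post g dpost (λ x∈post v≡x → proj₁ (after x∈post) ([_]-injective v≡x)))
    (λ (u<v , _) → toggles-other post g dpost
      λ { x∈post ≡.refl → proj₂ (after x∈post) ([<]⇒< u<v) })
    (λ (v<u , _) → ≡.trans
      (same λ { x∈pre ≡.refl → proj₂ (before x∈pre) ([<]⇒< v<u) })
      (T-other _ dv λ u≡v → proj₂ v<u (≡.sym u≡v)))

  record IsRowmotion (g h : Labeling) : Set (c ⊔ ℓ) where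
    field
      bottom    : h ⊥± ≡ g ⊥±
      top       : h ⊤± ≡ g ⊤±
      isToggled : ∀ v → IsToggled g h v

  R-isRowmotion : ∀ E g (d : Defined (R E g)) → IsRowmotion g (value (R E g) d)
  R-isRowmotion E g d = record
    { bottom    = toggles-other (list E) g d λ _ ()
    ; top       = toggles-other (list E) g d λ _ ()
    ; isToggled = λ v → toggles-isToggled (list-precedes E) (exhausts E v) g d
    }

  -- Unfolds the nested proof of definedness into a sequence over all times. Past time `n` it stays
  -- constant, and no step is claimed there.
  orbit : ∀ E f n (d : Defined ((R E ^ n) f)) →
          Σ[ φ ∈ (ℕ → Labeling) ] φ 0 ≡ f × φ n ≡ value ((R E ^ n) f) d ×
            (∀ {t} → t ℕ.< n → IsRowmotion (φ t) (φ (suc t)))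
  orbit E f zero    d = (λ _ → f) , ≡.refl , ≡.refl , λ ()
  orbit E f (suc n) (d , s) with orbit E f n d
  ... | φ , φ0≡f , φn≡ , step = φ′ , φ0≡f , φ′-last , step′
    where
    φ′ : ℕ → Labeling
    φ′ t = if does (t ℕ.≤? n) then φ t else value (R E (value ((R E ^ n) f) d)) s
    φ′≡φ : ∀ {t} → t ℕ.≤ n → φ′ t ≡ φ t
    φ′≡φ {t} t≤n rewrite dec-true (t ℕ.≤? n) t≤n = ≡.refl
    φ′-last : φ′ (suc n) ≡ value (R E (value ((R E ^ n) f) d)) s
    φ′-last rewrite dec-false (suc n ℕ.≤? n) ℕ.1+n≰n = ≡.refl
    step′ : ∀ {t} → t ℕ.< suc n → IsRowmotion (φ′ t) (φ′ (suc t))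
    step′ {t} t<1+n with ℕ.m≤n⇒m<n∨m≡n (s≤s⁻¹ t<1+n)
    ... | inj₁ t<n = ≡.subst₂ IsRowmotion (≡.sym (φ′≡φ (ℕ.<⇒≤ t<n))) (≡.sym (φ′≡φ t<n)) (step t<n)
    ... | inj₂ ≡.refl = ≡.subst₂ IsRowmotion (≡.sym (≡.trans (φ′≡φ ℕ.≤-refl) φn≡)) (≡.sym φ′-last)
                          (R-isRowmotion E _ s)

-- Coordinates on the extended rectangle and its cover relation.

module Coordinates (p q : ℕ) where
  open Extended (rectangle (suc p) (suc q))

  row col : P̂ → ℕ
  row ⊥±          = 1
  row [ i , j ]   = suc (toℕ i)
  row ⊤±          = suc p
  col ⊥±          = 0
  col [ i , j ]   = suc (toℕ j)
  col ⊤±          = suc (suc q)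

  pos : P̂ → ℕ × ℕ
  pos x = row x , col x

  infix 4 _⟶_
  _⟶_ : ℕ × ℕ → ℕ × ℕ → Set
  (m , n) ⟶ z = z ≡ (suc m , n) ⊎ z ≡ (m , suc n)

  -- The points for 0 and 1 lie componentwise below and above the whole rectangle, so `pos` embeds
  -- P̂ into ℕ × ℕ as a subposet.
  ≤̂⇒pos-≤ : ∀ {x y} → x ≤̂ y → row x ℕ.≤ row y × col x ℕ.≤ col y
  ≤̂⇒pos-≤ AddExtrema.⊥±≤⊥±            = ℕ.≤-refl , ℕ.≤-refl
  ≤̂⇒pos-≤ AddExtrema.⊥±≤[ _ ]         = s≤s z≤n , z≤n
  ≤̂⇒pos-≤ AddExtrema.⊥±≤⊤±            = s≤s z≤n , z≤n
  ≤̂⇒pos-≤ AddExtrema.[ i≤k , j≤l ]    = s≤s i≤k , s≤s j≤l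
  ≤̂⇒pos-≤ AddExtrema.[ (i , j) ]≤⊤±   = Fin.toℕ<n i , ℕ.<⇒≤ (s≤s (Fin.toℕ<n j))
  ≤̂⇒pos-≤ AddExtrema.⊤±≤⊤±            = ℕ.≤-refl , ℕ.≤-refl

  pos-≤⇒≤̂ : ∀ x y → row x ℕ.≤ row y → col x ℕ.≤ col y → x ≤̂ y
  pos-≤⇒≤̂ ⊥±        y         _   _   = AddExtrema.⊥±≤_ _ y
  pos-≤⇒≤̂ [ _ ]     [ _ ]     r≤r c≤c = AddExtrema.[ s≤s⁻¹ r≤r , s≤s⁻¹ c≤c ]
  pos-≤⇒≤̂ [ v ]     ⊤±        _   _   = AddExtrema.[ v ]≤⊤±
  pos-≤⇒≤̂ ⊤±        [ _ , j ] _   c≤c = contradiction (s≤s⁻¹ c≤c) (ℕ.<⇒≱ (Fin.toℕ<n j))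
  pos-≤⇒≤̂ ⊤±        ⊤±        _   _   = AddExtrema.⊤±≤⊤±

  pos-injective : ∀ {x y} → pos x ≡ pos y → x ≡ y
  pos-injective {⊥±}        {⊥±}        _  = ≡.refl
  pos-injective {⊥±}        {⊤±}        eq with () ← ≡.cong proj₂ eq
  pos-injective {⊤±}        {⊥±}        eq with () ← ≡.cong proj₂ eq
  pos-injective {[ i , j ]} {[ k , l ]} eq = ≡.cong₂ (λ i j → [ i , j ])
    (Fin.toℕ-injective (ℕ.suc-injective (≡.cong proj₁ eq)))
    (Fin.toℕ-injective (ℕ.suc-injective (≡.cong proj₂ eq)))
  pos-injective {[ _ , j ]} {⊤±}        eq =
    contradiction (ℕ.suc-injective (≡.cong proj₂ eq)) (ℕ.<⇒≢ (Fin.toℕ<n j))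
  pos-injective {⊤±}        {[ _ , j ]} eq =
    contradiction (ℕ.suc-injective (≡.cong proj₂ (≡.sym eq))) (ℕ.<⇒≢ (Fin.toℕ<n j))
  pos-injective {⊤±}        {⊤±}        _  = ≡.refl

  rank : P̂ → ℕ
  rank x = row x ℕ.+ col x

  rank-mono-< : ∀ {x y} → x <̂ y → rank x ℕ.< rank y
  rank-mono-< {x} {y} (x≤y , x≢y) with ≤̂⇒pos-≤ x≤y
  ... | r≤r , c≤c with ℕ.m≤n⇒m<n∨m≡n r≤r | ℕ.m≤n⇒m<n∨m≡n c≤c
  ...   | inj₁ r<r | _        = ℕ.+-mono-<-≤ r<r c≤c
  ...   | inj₂ _   | inj₁ c<c = ℕ.+-mono-≤-< r≤r c<c
  ...   | inj₂ r≡r | inj₂ c≡c = contradiction (pos-injective (≡.cong₂ _,_ r≡r c≡c)) x≢y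

  ⟶-rank : ∀ x y → pos x ⟶ pos y → rank y ≡ suc (rank x)
  ⟶-rank x y (inj₁ eq) = ≡.cong (λ (m , n) → m ℕ.+ n) eq
  ⟶-rank x y (inj₂ eq) = ≡.trans (≡.cong (λ (m , n) → m ℕ.+ n) eq) (ℕ.+-suc (row x) (col x))

  ⟶⇒≤̂ : ∀ x y → pos x ⟶ pos y → x ≤̂ y
  ⟶⇒≤̂ x y (inj₁ eq) = pos-≤⇒≤̂ x y (ℕ.≤-trans (ℕ.n≤1+n _) (ℕ.≤-reflexive (≡.sym (≡.cong proj₁ eq))))
                                   (ℕ.≤-reflexive (≡.sym (≡.cong proj₂ eq)))
  ⟶⇒≤̂ x y (inj₂ eq) = pos-≤⇒≤̂ x y (ℕ.≤-reflexive (≡.sym (≡.cong proj₁ eq)))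
                                   (ℕ.≤-trans (ℕ.n≤1+n _) (ℕ.≤-reflexive (≡.sym (≡.cong proj₂ eq))))

  ⟶⇒<̂ : ∀ x y → pos x ⟶ pos y → x <̂ y
  ⟶⇒<̂ x y s = ⟶⇒≤̂ x y s , λ { ≡.refl → ℕ.1+n≢n (≡.sym (⟶-rank x x s)) }

  -- The rank grows strictly along the order and by exactly one along a unit step, so nothing fits
  -- in between.
  ⟶⇒⋖ : ∀ x y → pos x ⟶ pos y → x ⋖ y
  ⟶⇒⋖ x y s = ⟶⇒<̂ x y s , λ (w , x<w , w<y) →
    ℕ.<⇒≱ (rank-mono-< x<w) (s≤s⁻¹ (ℕ.≤-trans (rank-mono-< w<y) (ℕ.≤-reflexive (⟶-rank x y s))))

  -- Every strict relation begins with a unit step that stays below its upper end; for a cover, this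
  -- step must already reach that end.
  next : ∀ x y → x <̂ y → ∃[ w ] pos x ⟶ pos w × row w ℕ.≤ row y × col w ℕ.≤ col y
  next ⊥± ⊥± (_ , x≢y) = contradiction ≡.refl x≢y
  next ⊥± [ i , j ] _ = [ Fin.zero , Fin.zero ] , inj₂ ≡.refl , s≤s z≤n , s≤s z≤n
  next ⊥± ⊤±        _ = [ Fin.zero , Fin.zero ] , inj₂ ≡.refl , s≤s z≤n , s≤s z≤n
  next [ i , j ] [ k , l ] (AddExtrema.[ i≤k , j≤l ] , x≢y)
    with ℕ.m≤n⇒m<n∨m≡n i≤k | ℕ.m≤n⇒m<n∨m≡n j≤l
  ... | inj₁ i<k | _ = [ fromℕ< 1+i<1+p , j ] ,
      inj₁ (≡.cong (λ m → suc m , suc (toℕ j)) (Fin.toℕ-fromℕ< 1+i<1+p)) ,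
      s≤s (≡.subst (ℕ._≤ toℕ k) (≡.sym (Fin.toℕ-fromℕ< 1+i<1+p)) i<k) , s≤s j≤l
    where 1+i<1+p = ℕ.≤-trans (s≤s i<k) (Fin.toℕ<n k)
  ... | inj₂ _ | inj₁ j<l = [ i , fromℕ< 1+j<1+q ] ,
      inj₂ (≡.cong (λ n → suc (toℕ i) , suc n) (Fin.toℕ-fromℕ< 1+j<1+q)) ,
      s≤s i≤k , s≤s (≡.subst (ℕ._≤ toℕ l) (≡.sym (Fin.toℕ-fromℕ< 1+j<1+q)) j<l)
    where 1+j<1+q = ℕ.≤-trans (s≤s j<l) (Fin.toℕ<n l)
  ... | inj₂ i≡k | inj₂ j≡l =
      contradiction (≡.cong₂ (λ i j → [ i , j ]) (Fin.toℕ-injective i≡k) (Fin.toℕ-injective j≡l)) x≢y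
  next [ i , j ] ⊤± _ with ℕ.m≤n⇒m<n∨m≡n (Fin.toℕ<n i) | ℕ.m≤n⇒m<n∨m≡n (Fin.toℕ<n j)
  ... | inj₁ 1+i<1+p | _ = [ fromℕ< 1+i<1+p , j ] ,
      inj₁ (≡.cong (λ m → suc m , suc (toℕ j)) (Fin.toℕ-fromℕ< 1+i<1+p)) ,
      Fin.toℕ<n (fromℕ< 1+i<1+p) , ℕ.<⇒≤ (s≤s (Fin.toℕ<n j))
  ... | inj₂ 1+i≡1+p | inj₁ 1+j<1+q = [ i , fromℕ< 1+j<1+q ] ,
      inj₂ (≡.cong (λ n → suc (toℕ i) , suc n) (Fin.toℕ-fromℕ< 1+j<1+q)) ,
      Fin.toℕ<n i , ℕ.<⇒≤ (s≤s (Fin.toℕ<n (fromℕ< 1+j<1+q)))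
  ... | inj₂ 1+i≡1+p | inj₂ 1+j≡1+q = ⊤± , inj₂ (≡.cong₂ (λ m n → m , suc n) (≡.sym 1+i≡1+p) (≡.sym 1+j≡1+q)) ,
      ℕ.≤-refl , ℕ.≤-refl
  next ⊤± y (⊤≤y , ⊤≢y) with ⊤≤y
  ... | AddExtrema.⊤±≤⊤± = contradiction ≡.refl ⊤≢y

  ⋖⇒⟶ : ∀ {x y} → x ⋖ y → pos x ⟶ pos y
  ⋖⇒⟶ {x} {y} (x<y , ¬between) with next x y x<y
  ... | w , x⟶w , r≤r , c≤c with w ≟̂ y
  ...   | yes ≡.refl = x⟶w
  ...   | no  w≢y    = contradiction (w , ⟶⇒<̂ x w x⟶w , pos-≤⇒≤̂ w y r≤r c≤c , w≢y) ¬between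

  elementŝ-unique : Unique elementŝ
  elementŝ-unique = ((λ ()) ∷ All.map⁺ (All.universal (λ _ ()) _)) ∷ (All.map⁺ (All.universal (λ _ ()) _)) ∷
    Unique.map⁺ [_]-injective (FinitePoset.unique (rectangle (suc p) (suc q)))

  pos-row0 : ∀ {n} x → pos x ≢ (0 , n)
  pos-row0 ⊥± ()
  pos-row0 [ _ ] ()
  pos-row0 ⊤± ()

  pos-col0 : ∀ {m} x → pos x ≢ (suc (suc m) , 0)
  pos-col0 ⊥± ()
  pos-col0 [ _ ] ()
  pos-col0 ⊤± ()

  pos-row≤ : ∀ {m n} x → pos x ≡ (m , n) → m ℕ.≤ suc p
  pos-row≤ ⊥±          ≡.refl = s≤s z≤n
  pos-row≤ [ i , _ ]   ≡.refl = Fin.toℕ<n i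
  pos-row≤ ⊤±          ≡.refl = ℕ.≤-refl

  pos-top : ∀ {m n} x → pos x ≡ (m , suc (suc n)) → q ℕ.≤ n → m ≡ suc p
  pos-top [ _ , j ] eq     q≤n =
    contradiction (ℕ.suc-injective (≡.cong proj₂ eq)) (ℕ.<⇒≢ (ℕ.≤-trans (Fin.toℕ<n j) (s≤s q≤n)))
  pos-top ⊤±        ≡.refl _   = ≡.refl

  pos? : ∀ z x → Dec (pos x ≡ z)
  pos? z x = ≡-dec ℕ._≟_ ℕ._≟_ (pos x) z

  at : ℕ → ℕ → List P̂
  at m n = filter (pos? (m , n)) elementŝ

-- Labelings as arrays on ℕ × ℕ.

module Charts {c ℓ} (K : Ring c ℓ) (p q : ℕ) where
  open Ring K renaming (Carrier to 𝕂)
  open Coordinates p q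
  open Rowmotion K (rectangle (suc p) (suc q))
  open Dynamics K (rectangle (suc p) (suc q))

  -- At most one element sits at a point, so the sum is its label, or 0 at an unoccupied point.
  chart : Labeling → ℕ → ℕ → 𝕂
  chart f m n = ∑ (map f (at m n))

  chart-pos : ∀ f x → chart f (row x) (col x) ≈ f x
  chart-pos f x rewrite filter-unique (pos? (pos x)) ≡.refl pos-injective
                                      (completê x) elementŝ-unique = +-identityʳ _

  chart-outside : ∀ f {m n} → (∀ x → pos x ≢ (m , n)) → chart f m n ≈ 0#
  chart-outside f {m} {n} outside
    rewrite filter-none (pos? (m , n)) {xs = elementŝ} (All.universal outside _) = refl

  -- Covers are unit steps, so the sum splits by the two possible positions; an unoccupied one
  -- contributes 0.
  lowerCovers-chart : ∀ f i j → ∑ (map f (lowerCovers [ i , j ])) ≈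
                      chart f (toℕ i) (suc (toℕ j)) + chart f (suc (toℕ i)) (toℕ j)
  lowerCovers-chart f i j = ∑-filter-⊎ (_⋖? [ i , j ]) (pos? _) (pos? _)
    (λ x⋖v → [ (λ eq → inj₁ (≡.cong (λ (m , n) → ℕ.pred m , n) (≡.sym eq)))
             , (λ eq → inj₂ (≡.cong (λ (m , n) → m , ℕ.pred n) (≡.sym eq))) ]′ (⋖⇒⟶ x⋖v))
    (λ {x} eq → ⟶⇒⋖ x [ i , j ] (inj₁ (≡.sym (≡.cong (λ (m , n) → suc m , n) eq))))
    (λ {x} eq → ⟶⇒⋖ x [ i , j ] (inj₂ (≡.sym (≡.cong (λ (m , n) → m , suc n) eq))))
    (λ eq eq′ → ℕ.1+n≢n (≡.trans (≡.sym (≡.cong proj₁ eq′)) (≡.cong proj₁ eq)))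
    f elementŝ

  upperCovers-chart : ∀ f i j → ∑ (map f (upperCovers [ i , j ])) ≈
                      chart f (suc (suc (toℕ i))) (suc (toℕ j)) + chart f (suc (toℕ i)) (suc (suc (toℕ j)))
  upperCovers-chart f i j = ∑-filter-⊎ ([ i , j ] ⋖?_) (pos? _) (pos? _) ⋖⇒⟶
    (λ {x} eq → ⟶⇒⋖ [ i , j ] x (inj₁ eq))
    (λ {x} eq → ⟶⇒⋖ [ i , j ] x (inj₂ eq))
    (λ eq eq′ → ℕ.1+n≢n (≡.trans (≡.sym (≡.cong proj₁ eq)) (≡.cong proj₁ eq′)))
    f elementŝ

  lowerCovers-origin : ∀ f → ∑ (map f (lowerCovers [ Fin.zero , Fin.zero ])) ≈ f ⊥±
  lowerCovers-origin f = trans (lowerCovers-chart f Fin.zero Fin.zero)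
    (trans (+-cong (chart-outside f pos-row0) (chart-pos f ⊥±)) (+-identityˡ _))

  chart-cell : ∀ f {i j} (i≤p : i ℕ.≤ p) (j≤q : j ℕ.≤ q) →
               chart f (suc i) (suc j) ≈ f [ fromℕ< (s≤s i≤p) , fromℕ< (s≤s j≤q) ]
  chart-cell f i≤p j≤q = ≡.subst₂ (λ m n → chart f (suc m) (suc n) ≈ f v)
    (Fin.toℕ-fromℕ< (s≤s i≤p)) (Fin.toℕ-fromℕ< (s≤s j≤q)) (chart-pos f v)
    where v = [ fromℕ< (s≤s i≤p) , fromℕ< (s≤s j≤q) ]

-- Invertibility along the orbit and construction of the grid.

module Orbit {c ℓ} (K : Ring c ℓ) (p q : ℕ) {N : ℕ} (1<N : 1 ℕ.< N)
  (φ : ℕ → Rowmotion.Labeling K (rectangle (suc p) (suc q)))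
  (step : ∀ {t} → t ℕ.< N → Dynamics.IsRowmotion K (rectangle (suc p) (suc q)) (φ t) (φ (suc t))) where

  open Ring K renaming (Carrier to 𝕂)
  open Rowmotion K (rectangle (suc p) (suc q))
  open Dynamics K (rectangle (suc p) (suc q))
  open Coordinates p q
  open Charts K p q
  open import Algebra.Properties.Monoid *-monoid using (cancelʳ)
  open import Relation.Binary.Reasoning.Setoid setoid
  open IsRowmotion
  open IsToggled

  φ-⊥ : ∀ {t} → t ℕ.≤ N → φ t ⊥± ≡ φ 0 ⊥±
  φ-⊥ {zero}  _   = ≡.refl
  φ-⊥ {suc t} t<N = ≡.trans (bottom (step t<N)) (φ-⊥ (ℕ.<⇒≤ t<N))

  φ-⊤ : ∀ {t} → t ℕ.≤ N → φ t ⊤± ≡ φ 0 ⊤±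
  φ-⊤ {zero}  _   = ≡.refl
  φ-⊤ {suc t} t<N = ≡.trans (top (step t<N)) (φ-⊤ (ℕ.<⇒≤ t<N))

  φ-origin : ∀ {t} → t ℕ.< N → ∃[ y ] Invertible y × φ (suc t) [ Fin.zero , Fin.zero ] ≈ φ 0 ⊥± * y
  φ-origin {t} t<N with divides (isToggled (step t<N) (Fin.zero , Fin.zero))
  ... | y , y⁻¹ , eq = y , y⁻¹ ,
    trans eq (*-congʳ (trans (lowerCovers-origin (φ t)) (reflexive (φ-⊥ (ℕ.<⇒≤ t<N)))))

  -- After the first step the least element of the rectangle carries `a` times an invertible factor,
  -- and the second step inverts this label.
  ⊥-invertible : Invertible (φ 0 ⊥±)
  ⊥-invertible with φ-origin (ℕ.<⇒≤ 1<N)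
  ... | y , y⁻¹ , eq =
    Invertible-cancelʳ y⁻¹ (Invertible-resp-≈ eq (old (isToggled (step 1<N) (Fin.zero , Fin.zero))))

  -- 1 covers the greatest element of the rectangle, so the first toggle there inverts its label.
  ⊤-invertible : Invertible (φ 0 ⊤±)
  ⊤-invertible = ≡.subst Invertible (φ-⊤ (ℕ.<⇒≤ 1<N))
    (new (isToggled (step (ℕ.<⇒≤ 1<N)) (fromℕ p , fromℕ q))
      (⟶⇒⋖ [ fromℕ p , fromℕ q ] ⊤±
        (inj₂ (≡.cong₂ (λ m n → suc m , suc (suc n)) (≡.sym (Fin.toℕ-fromℕ p)) (≡.sym (Fin.toℕ-fromℕ q))))))

  -- At the final time no later step inverts the labels, so the argument uses the step just made: a
  -- non-minimal `v` covers some element of the rectangle, whose toggle inverts the new label of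
  -- `v`.
  new-invertible : ∀ {t} → t ℕ.< N → ∀ v → Invertible (φ (suc t) [ v ])
  new-invertible t<N (Fin.zero , Fin.zero) with φ-origin t<N
  ... | y , y⁻¹ , eq = Invertible-resp-≈ (sym eq) (Invertible-* ⊥-invertible y⁻¹)
  new-invertible t<N (Fin.suc i , j) = new (isToggled (step t<N) (inject₁ i , j))
    (⟶⇒⋖ [ inject₁ i , j ] [ Fin.suc i , j ]
      (inj₁ (≡.cong (λ m → suc (suc m) , _) (≡.sym (Fin.toℕ-inject₁ i)))))
  new-invertible t<N (i , Fin.suc j) = new (isToggled (step t<N) (i , inject₁ j))
    (⟶⇒⋖ [ i , inject₁ j ] [ i , Fin.suc j ]
      (inj₂ (≡.cong (λ n → _ , suc (suc n)) (≡.sym (Fin.toℕ-inject₁ j)))))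

  invertible : ∀ {t} → t ℕ.≤ N → ∀ x → Invertible (φ t x)
  invertible         t≤N ⊥±    = ≡.subst Invertible (≡.sym (φ-⊥ t≤N)) ⊥-invertible
  invertible         t≤N ⊤±    = ≡.subst Invertible (≡.sym (φ-⊤ t≤N)) ⊤-invertible
  invertible {zero}  t≤N [ v ] = old (isToggled (step (ℕ.<⇒≤ 1<N)) v)
  invertible {suc t} t<N [ v ] = new-invertible t<N v

  -- Invertibility is established only up to time `N`; the 0 afterwards is a filler.
  φ⁻¹ : ℕ → Labeling
  φ⁻¹ t x with t ℕ.≤? N
  ... | yes t≤N = inv (invertible t≤N x)
  ... | no  _   = 0#

  φ-φ⁻¹ : ∀ {t} → t ℕ.≤ N → ∀ x → φ t x * φ⁻¹ t x ≈ 1#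
  φ-φ⁻¹ {t} t≤N x with t ℕ.≤? N
  ... | yes t≤N = proj₂ (proj₂ (invertible t≤N x))
  ... | no  t≰N = contradiction t≤N t≰N

  φ⁻¹-φ : ∀ {t} → t ℕ.≤ N → ∀ x → φ⁻¹ t x * φ t x ≈ 1#
  φ⁻¹-φ {t} t≤N x with t ℕ.≤? N
  ... | yes t≤N = proj₁ (proj₂ (invertible t≤N x))
  ... | no  t≰N = contradiction t≤N t≰N

  φ⁻¹-⊤ : ∀ {t} → t ℕ.≤ N → φ⁻¹ t ⊤± ≈ inv ⊤-invertible
  φ⁻¹-⊤ t≤N = inverse-unique (φ⁻¹-φ t≤N ⊤±)
    (trans (*-congʳ (reflexive (φ-⊤ t≤N))) (proj₂ (proj₂ ⊤-invertible)))

  private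
    F G : ℕ → ℕ → ℕ → 𝕂
    F t = chart (φ t)
    G t = chart (φ⁻¹ t)

  toggle-Fin : ∀ {t} → t ℕ.< N → ∀ i j →
    F (suc t) (suc (toℕ i)) (suc (toℕ j)) *
      (G (suc t) (suc (suc (toℕ i))) (suc (toℕ j)) + G (suc t) (suc (toℕ i)) (suc (suc (toℕ j)))) ≈
    (F t (toℕ i) (suc (toℕ j)) + F t (suc (toℕ i)) (toℕ j)) * G t (suc (toℕ i)) (suc (toℕ j))
  toggle-Fin {t} t<N i j = begin
    F (suc t) (suc (toℕ i)) (suc (toℕ j)) *
      (G (suc t) (suc (suc (toℕ i))) (suc (toℕ j)) + G (suc t) (suc (toℕ i)) (suc (suc (toℕ j))))
      ≈⟨ *-cong (chart-pos (φ (suc t)) [ i , j ]) (sym (upperCovers-chart (φ⁻¹ (suc t)) i j)) ⟩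
    φ (suc t) [ i , j ] * ∑ (map (φ⁻¹ (suc t)) (upperCovers [ i , j ]))
      ≈⟨ toggled (isToggled (step t<N) (i , j)) (φ⁻¹ (suc t)) (λ {u} _ → φ-φ⁻¹ t<N u) ⟩
    ∑ (map (φ t) (lowerCovers [ i , j ])) * inv (old (isToggled (step t<N) (i , j)))
      ≈⟨ *-cong (lowerCovers-chart (φ t) i j)
                (trans (inverse-unique (proj₁ (proj₂ (old (isToggled (step t<N) (i , j)))))
                                       (φ-φ⁻¹ (ℕ.<⇒≤ t<N) [ i , j ]))
                       (sym (chart-pos (φ⁻¹ t) [ i , j ]))) ⟩
    (F t (toℕ i) (suc (toℕ j)) + F t (suc (toℕ i)) (toℕ j)) * G t (suc (toℕ i)) (suc (toℕ j)) ∎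

  grid : Grid K p q N
  grid = record
    { F = F
    ; G = G
    ; a = φ 0 ⊥±
    ; a⁻¹ = inv ⊥-invertible
    ; b = φ 0 ⊤±
    ; b⁻¹ = inv ⊤-invertible
    ; aa⁻¹ = proj₂ (proj₂ ⊥-invertible)
    ; a⁻¹a = proj₁ (proj₂ ⊥-invertible)
    ; bb⁻¹ = proj₂ (proj₂ ⊤-invertible)
    ; b⁻¹b = proj₁ (proj₂ ⊤-invertible)
    ; FG = λ {t} t≤N i≤p j≤q →
        trans (*-cong (chart-cell (φ t) i≤p j≤q) (chart-cell (φ⁻¹ t) i≤p j≤q)) (φ-φ⁻¹ t≤N _)
    ; GF = λ {t} t≤N i≤p j≤q →
        trans (*-cong (chart-cell (φ⁻¹ t) i≤p j≤q) (chart-cell (φ t) i≤p j≤q)) (φ⁻¹-φ t≤N _)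
    ; F-left = λ t j → chart-outside (φ t) pos-row0
    ; F-bottom = λ t i → chart-outside (φ t) pos-col0
    ; F-origin = λ {t} t≤N → trans (chart-pos (φ t) ⊥±) (reflexive (φ-⊥ t≤N))
    ; G-right = λ t _ → chart-outside (φ⁻¹ t) λ x eq → ℕ.1+n≰n (pos-row≤ x eq)
    ; G-top = λ t i<p → chart-outside (φ⁻¹ t) λ x eq → ℕ.<⇒≢ (s≤s i<p) (pos-top x eq ℕ.≤-refl)
    ; G-end = λ {t} t≤N → trans (chart-pos (φ⁻¹ t) ⊤±) (φ⁻¹-⊤ t≤N)
    ; toggle = λ {t} {i} {j} t<N i≤p j≤q → ≡.subst₂
        (λ i j → F (suc t) (suc i) (suc j) * (G (suc t) (suc (suc i)) (suc j) + G (suc t) (suc i) (suc (suc j)))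
                   ≈ (F t i (suc j) + F t (suc i) j) * G t (suc i) (suc j))
        (Fin.toℕ-fromℕ< (s≤s i≤p)) (Fin.toℕ-fromℕ< (s≤s j≤q))
        (toggle-Fin t<N (fromℕ< (s≤s i≤p)) (fromℕ< (s≤s j≤q)))
    }

  orbit-periodic : N ≡ suc p ℕ.+ suc q → ∀ x →
                   φ N x ≈ φ 0 ⊥± * inv ⊤-invertible * φ 0 x * inv ⊥-invertible * φ 0 ⊤±
  orbit-periodic N≡ ⊥± = begin
    φ N ⊥±                  ≡⟨ φ-⊥ ℕ.≤-refl ⟩
    a                       ≈⟨ cancelʳ b⁻¹b a ⟨
    a * b⁻¹ * b             ≈⟨ *-congʳ (cancelʳ aa⁻¹ (a * b⁻¹)) ⟨
    a * b⁻¹ * a * a⁻¹ * b   ∎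
    where open Grid grid using (a; a⁻¹; b; b⁻¹; aa⁻¹; b⁻¹b)
  orbit-periodic N≡ ⊤± = begin
    φ N ⊤±                  ≡⟨ φ-⊤ ℕ.≤-refl ⟩
    b                       ≈⟨ *-identityˡ b ⟨
    1# * b                  ≈⟨ *-congʳ aa⁻¹ ⟨
    a * a⁻¹ * b             ≈⟨ *-congʳ (*-congʳ (cancelʳ b⁻¹b a)) ⟨
    a * b⁻¹ * b * a⁻¹ * b   ∎
    where open Grid grid using (a; a⁻¹; b; b⁻¹; aa⁻¹; b⁻¹b)
  orbit-periodic N≡ x@([ i , j ]) = begin
    φ N x                       ≈⟨ chart-pos (φ N) x ⟨
    F N (row x) (col x)         ≈⟨ periodicity N≡ (s≤s⁻¹ (Fin.toℕ<n i)) (s≤s⁻¹ (Fin.toℕ<n j)) ⟩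
    a * b⁻¹ * F 0 (row x) (col x) * a⁻¹ * b
                                ≈⟨ *-congʳ (*-congʳ (*-congˡ (chart-pos (φ 0) x))) ⟩
    a * b⁻¹ * φ 0 x * a⁻¹ * b   ∎
    where
    open Grid grid using (a; a⁻¹; b; b⁻¹)
    open Reciprocity grid using (periodicity)

theorem4p7 : ∀ {c ℓ} (K : Ring c ℓ) (p q : ℕ) .{{_ : ℕ.NonZero p}} .{{_ : ℕ.NonZero q}} →
    let open Ring K using (_≈_)
        open Ring K using (_*_)
        open Rowmotion K (rectangle p q)
    in
    (L : LinearExtension) (f : Labeling) (d : Defined ((R L ^ (p ℕ.+ q)) f)) →
    let a = f ⊥±
        b = f ⊤±
    in
    Σ[ a⁻¹ ∈ Invertible a ] Σ[ b⁻¹ ∈ Invertible b ]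
      (∀ (x : P̂) →
        value ((R L ^ (p ℕ.+ q)) f) d x ≈ a * inv b⁻¹ * f x * inv a⁻¹ * b)
theorem4p7 K (suc p) (suc q) L f d
  with Dynamics.orbit K (rectangle (suc p) (suc q)) L f (suc p ℕ.+ suc q) d
... | φ , ≡.refl , φN≡ , step = ⊥-invertible , ⊤-invertible , λ x →
  trans (reflexive (≡.cong (λ g → g x) (≡.sym φN≡))) (orbit-periodic ≡.refl x)
  where
  open Ring K using (trans; reflexive)
  -- Both side lengths are positive, so at least two steps are available.
  open Orbit K p q (s≤s (ℕ.≤-trans (s≤s z≤n) (ℕ.m≤n+m (suc q) p))) φ step
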